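{- Let $p=3$, $1\le m\le n-1$, and let $I=[m]_2\cup B$ be a saturated generalized order ideal of $\mathbb{GH}(m,n)$ in which every element of $[m]$ has multiplicity $2$ and $B$ has nonzero multiplicity vector $v_B\in\{0,1,2\}^{n-m}$ on $[n]\setminus[m]$, so that $I(\mathbb{GP})=(\mathbb{F}_3^m\times0)\cup\big(\{2\}^m\times(\mathrm{box}(v_B)\setminus0)\big)$. Let $D=\mathbb{F}_3^n\setminus I(\mathbb{GP})$, so that $|D|=3^n-3^m-2^{t_1}3^{t_2}+1$, with $t_1,t_2$ referring to $v_B$. For nonzero $u=(v,w)$, $v\in\mathbb{F}_3^m$, $w\in\mathbb{F}_3^{n-m}$, with $\sigma=\sum_{i\le m}v_i\in\mathbb{F}_3$, \[ \mathrm{wt}(c_D(u))=\tfrac13\Big(2|D|+2\cdot3^m[v=0]+3^{t_2}e(w)\,2^{z(w)}(-1)^{o(w)}\phi(\sigma+s_1(w))-\phi(\sigma)\Big). \] The number of nonzero $u$ in the class determined by $[v=0]$, $\sigma$, $e(w)=e$, $z(w)=z$, $s_1(w)=c$ is the product of the number of $v$ in the class (namely $1$ for $v=0$; $3^{m-1}-1$ for $v\ne0$, $\sigma=0$; $3^{m-1}$ for each given value $\sigma\ne0$) and \[ \big([e=1]+(3^{t_2}-1)[e=0]\big)\binom{t_1}{z}N_c(t_1-z)\,3^{n-m-t_1-t_2}, \] less one for the class containing $u=0$.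
   Context: $[n]=\{1,\dots,n\}$; $[\,\cdot\,]$ applied to a condition is $1$ if it holds and $0$ otherwise; $\mathrm{wt}$ is Hamming weight; $c_D(u)=(u\cdot x)_{x\in D}$ with $u\cdot x=\sum_iu_ix_i\in\mathbb{F}_3$. $\mathbb{F}_3$ is identified with $\{0,1,2\}$. Generalized order ideals ($p=3$): $[n]_2$ is the multiset in which each $i\in[n]$ has multiplicity $2$. A sub-multiset $J$ is identified with its multiplicity vector $(J_1,\dots,J_n)\in\{0,1,2\}^n=\mathbb{F}_3^n$; $J\subseteq J'$ means $J_i\le J'_i$ (as integers) for all $i$; $\bar J=\{i:J_i\ne0\}$. The hierarchical poset $\mathbb{H}(m,n)$ on $[n]$ has as its only strict relations $i\prec j$ for all $i\in[m]$, $j\in[n]\setminus[m]$; $\mathbb{GH}(m,n)$ denotes $[n]_2$ together with this order. $J$ is a saturated generalized order ideal if $\bar J$ is a down-closed subset of $\mathbb{H}(m,n)$ and $J_i=2$ whenever $j\in\bar J$ and $i\prec j$. $I(\mathbb{GP})\subseteq\mathbb{F}_3^n$ is the set of all saturated generalized order ideals contained in $I$. Notation attached to $v_B\in\{0,1,2\}^{n-m}$: $T_j=\{i:(v_B)_i=j\}$, $t_j=|T_j|$, $\mathrm{box}(v_B)=\prod_i\{0,\dots,(v_B)_i\}\subseteq\mathbb{F}_3^{n-m}$. For $w\in\mathbb{F}_3^{n-m}$: $z(w)=|\{i\in T_1:w_i=0\}|$, $o(w)=t_1-z(w)$, $s_1(w)=\sum_{i\in T_1}w_i\in\mathbb{F}_3$,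 $e(w)=1$ if $w_i=0$ for all $i\in T_2$ and $e(w)=0$ otherwise. For $c\in\mathbb{F}_3$, $\phi(c)=2[c=0]-[c\ne0]$. For an integer $o\ge0$ and $c\in\mathbb{F}_3$, $N_c(o)$ is the number of vectors in $\{1,2\}^o$ whose coordinate sum is $c$ in $\mathbb{F}_3$, i.e. $N_0(o)=(2^o+2(-1)^o)/3$ and $N_c(o)=(2^o-(-1)^o)/3$ for $c\ne0$. -}

module Defs where

open import Data.Fin using (Fin; zero; suc; toℕ)
import Data.Fin as Fin
open import Data.Fin.Patterns using (0F; 1F; 2F)
import Data.Fin.Properties as Fin
open import Data.Integer using (ℤ; +_)
import Data.Integer as ℤ
open import Data.List using (List; []; _∷_; [_]; length; filter; map; allFin; cartesianProductWith)
import Data.List as List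
open import Data.List.Membership.Propositional using (_∈_)
open import Data.List.Membership.Propositional.Properties using (∈-allFin; ∈-cartesianProductWith⁺)
open import Data.List.Relation.Unary.All using (all?)
open import Data.List.Relation.Unary.Any using (here)
import Data.List.Relation.Unary.All as All
import Data.List.Relation.Unary.AllPairs as AllPairs
open import Data.List.Relation.Unary.Unique.Propositional using (Unique)
import Data.List.Relation.Unary.Unique.Propositional.Properties as Unique
open import Data.Nat using (ℕ; _≤_; _<_; _∸_)
import Data.Nat as ℕ
open import Data.Nat.DivMod using (_mod_)
import Data.Nat.Properties as ℕ
open import Data.Product using (_×_; _,_)
open import Data.Vec using (Vec; []; _∷_; lookup; replicate; zipWith; foldr′; take; drop)
import Data.Vec.Properties as Vec
open import Level using (0ℓ; _⊔_)
open import Relation.Binary using (Rel; IsStrictPartialOrder)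
import Relation.Binary as Binary
open import Relation.Binary.PropositionalEquality using (_≡_; _≢_; refl; isEquivalence; resp₂)
open import Relation.Nullary using (Dec; yes; no; ¬?; _×-dec_; _→-dec_)
open import Relation.Unary using (Pred; Decidable)
open import Relation.Unary.Properties using (∁?)

⟦_⟧ : ∀ {p} {P : Set p} → Dec P → ℕ
⟦ yes _ ⟧ = 1
⟦ no  _ ⟧ = 0

-- The field 𝔽₃ is {0,1,2} with arithmetic modulo 3.

𝔽₃ : Set
𝔽₃ = Fin 3

infixl 6 _⊕_
infixl 7 _⊗_ _·_

_⊕_ _⊗_ : 𝔽₃ → 𝔽₃ → 𝔽₃
a ⊕ b = (toℕ a ℕ.+ toℕ b) mod 3
a ⊗ b = (toℕ a ℕ.* toℕ b) mod 3

𝔽₃^ : ℕ → Set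
𝔽₃^ n = Vec 𝔽₃ n

𝟎 𝟐 : ∀ {n} → 𝔽₃^ n
𝟎 = replicate _ 0F
𝟐 = replicate _ 2F

infix 4 _≟_

_≟_ : ∀ {n} → Binary.DecidableEquality (𝔽₃^ n)
_≟_ = Vec.≡-dec Fin._≟_

Σ𝔽₃ : ∀ {n} → 𝔽₃^ n → 𝔽₃
Σ𝔽₃ = foldr′ _⊕_ 0F

_·_ : ∀ {n} → 𝔽₃^ n → 𝔽₃^ n → 𝔽₃
u · x = Σ𝔽₃ (zipWith _⊗_ u x)

-- Subsets of 𝔽₃ⁿ are decidable predicates; their elements are listed, and
-- counted, by filtering the following enumeration of 𝔽₃ⁿ.

vectors : ∀ n → List (𝔽₃^ n)
vectors 0         = [ [] ]
vectors (ℕ.suc n) = cartesianProductWith _∷_ (allFin 3) (vectors n)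

vectors-complete : ∀ {n} (x : 𝔽₃^ n) → x ∈ vectors n
vectors-complete []      = here refl
vectors-complete (a ∷ x) = ∈-cartesianProductWith⁺ _∷_ (∈-allFin a) (vectors-complete x)

vectors-unique : ∀ n → Unique (vectors n)
vectors-unique 0         = All.[] AllPairs.∷ AllPairs.[]
vectors-unique (ℕ.suc n) =
  Unique.cartesianProductWith⁺ _∷_ Vec.∷-injective (Unique.allFin⁺ 3) (vectors-unique n)

module _ {n p} {P : Pred (𝔽₃^ n) p} (P? : Decidable P) where

  elements : List (𝔽₃^ n)
  elements = filter P? (vectors n)

  # : ℕ
  # = length elements

infixr 7 _⊠_ _⊠?_

_⊠_ : ∀ {m k p q} → Pred (𝔽₃^ m) p → Pred (𝔽₃^ k) q → Pred (𝔽₃^ (m ℕ.+ k)) (p ⊔ q)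
_⊠_ {m} P Q u = P (take m u) × Q (drop m u)

_⊠?_ : ∀ {m k p q} {P : Pred (𝔽₃^ m) p} {Q : Pred (𝔽₃^ k) q} →
       Decidable P → Decidable Q → Decidable (P ⊠ Q)
_⊠?_ {m} P? Q? u = P? (take m u) ×-dec Q? (drop m u)

codeword : ∀ {n} → List (𝔽₃^ n) → 𝔽₃^ n → List 𝔽₃
codeword D u = map (u ·_) D

wt : List 𝔽₃ → ℕ
wt c = length (filter (λ a → ¬? (a Fin.≟ 0F)) c)

-- A sub-multiset of [n]₂ is its multiplicity vector in {0,1,2}ⁿ = 𝔽₃ⁿ.

infix 4 _⊑_

_⊑_ : ∀ {n} → Rel (𝔽₃^ n) 0ℓ
J ⊑ J′ = ∀ i → lookup J i Fin.≤ lookup J′ i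

_⊑?_ : ∀ {n} → Binary.Decidable (_⊑_ {n})
J ⊑? J′ = Fin.all? λ i → lookup J i Fin.≤? lookup J′ i

Supp : ∀ {n} → 𝔽₃^ n → Pred (Fin n) 0ℓ
Supp J i = lookup J i ≢ 0F

Supp? : ∀ {n} (J : 𝔽₃^ n) → Decidable (Supp J)
Supp? J i = ¬? (lookup J i Fin.≟ 0F)

Box : ∀ {n} → 𝔽₃^ n → Pred (𝔽₃^ n) 0ℓ
Box b x = x ⊑ b

module _ {n} (_≺_ : Rel (Fin n) 0ℓ) where

  -- Closure under the strict order is the same as closure under its
  -- reflexive closure.
  DownClosed : Pred (Pred (Fin n) 0ℓ) 0ℓ
  DownClosed S = ∀ i j → i ≺ j → S j → S i

  SaturatedIdeal : Pred (𝔽₃^ n) 0ℓ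
  SaturatedIdeal J =
    DownClosed (Supp J) × (∀ i j → i ≺ j → Supp J j → lookup J i ≡ 2F)

  -- I(𝔾ℙ)
  Ideals⊑ : 𝔽₃^ n → Pred (𝔽₃^ n) 0ℓ
  Ideals⊑ I J = SaturatedIdeal J × J ⊑ I

  module _ (_≺?_ : Binary.Decidable _≺_) where

    SaturatedIdeal? : Decidable SaturatedIdeal
    SaturatedIdeal? J =
      (Fin.all? λ i → Fin.all? λ j → (i ≺? j) →-dec (Supp? J j →-dec Supp? J i))
      ×-dec
      (Fin.all? λ i → Fin.all? λ j → (i ≺? j) →-dec (Supp? J j →-dec (lookup J i Fin.≟ 2F)))

    Ideals⊑? : ∀ I → Decidable (Ideals⊑ I)
    Ideals⊑? I J = SaturatedIdeal? J ×-dec (J ⊑? I)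

-- The strict order of ℍ(m,n).  The element i of [n] is the (i-1)-st element of
-- Fin n, so i ∈ [m] reads toℕ i < m.
ℍ : ∀ m n → Rel (Fin n) 0ℓ
ℍ m n i j = toℕ i < m × m ≤ toℕ j

ℍ? : ∀ m n → Binary.Decidable (ℍ m n)
ℍ? m n i j = (toℕ i ℕ.<? m) ×-dec (m ℕ.≤? toℕ j)

ℍ-isStrictPartialOrder : ∀ m n → IsStrictPartialOrder _≡_ (ℍ m n)
ℍ-isStrictPartialOrder m n = record
  { isEquivalence = isEquivalence
  ; irrefl        = λ { refl (i<m , m≤i) → ℕ.<⇒≱ i<m m≤i }
  ; trans         = λ { (i<m , _) (_ , m≤k) → i<m , m≤k }
  ; <-resp-≈      = resp₂ (ℍ m n)
  }

complement : ∀ m n → 𝔽₃^ n → List (𝔽₃^ n)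
complement m n I = elements (∁? (Ideals⊑? (ℍ m n) (ℍ? m n) I))

module _ {k} (b : 𝔽₃^ k) where

  T : 𝔽₃ → List (Fin k)
  T j = filter (λ i → lookup b i Fin.≟ j) (allFin k)

  t : 𝔽₃ → ℕ
  t j = length (T j)

  z : 𝔽₃^ k → ℕ
  z w = length (filter (λ i → lookup w i Fin.≟ 0F) (T 1F))

  o : 𝔽₃^ k → ℕ
  o w = t 1F ∸ z w

  s₁ : 𝔽₃^ k → 𝔽₃
  s₁ w = List.foldr _⊕_ 0F (map (lookup w) (T 1F))

  e : 𝔽₃^ k → ℕ
  e w = ⟦ all? (λ i → lookup w i Fin.≟ 0F) (T 2F) ⟧

φ : 𝔽₃ → ℤ
φ c = + 2 ℤ.* + ⟦ c Fin.≟ 0F ⟧ ℤ.- + ⟦ ¬? (c Fin.≟ 0F) ⟧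

Nonzero : ∀ {n} → Pred (𝔽₃^ n) 0ℓ
Nonzero x = x ≢ 𝟎

Nonzero? : ∀ {n} → Decidable (Nonzero {n})
Nonzero? x = ¬? (x ≟ 𝟎)

-- Vectors in {1,2}ᵒ are those with full support.
N : 𝔽₃ → ℕ → ℕ
N c o = # {o} λ x → Fin.all? (Supp? x) ×-dec (Σ𝔽₃ x Fin.≟ c)

-- The classes of v, of w, and of u = (v,w), given by prescribed values of
-- [v = 0], σ and of e(w), z(w), s₁(w).

VClass : ∀ {m} → ℕ → 𝔽₃ → Pred (𝔽₃^ m) 0ℓ
VClass a s v = ⟦ v ≟ 𝟎 ⟧ ≡ a × Σ𝔽₃ v ≡ s

VClass? : ∀ {m} a s → Decidable (VClass {m} a s)
VClass? a s v = (⟦ v ≟ 𝟎 ⟧ ℕ.≟ a) ×-dec (Σ𝔽₃ v Fin.≟ s)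

WClass : ∀ {k} → 𝔽₃^ k → ℕ → ℕ → 𝔽₃ → Pred (𝔽₃^ k) 0ℓ
WClass b ε ζ c w = e b w ≡ ε × z b w ≡ ζ × s₁ b w ≡ c

WClass? : ∀ {k} (b : 𝔽₃^ k) ε ζ c → Decidable (WClass b ε ζ c)
WClass? b ε ζ c w = (e b w ℕ.≟ ε) ×-dec (z b w ℕ.≟ ζ) ×-dec (s₁ b w Fin.≟ c)

UClass : ∀ {m k} → 𝔽₃^ k → ℕ → 𝔽₃ → ℕ → ℕ → 𝔽₃ → Pred (𝔽₃^ (m ℕ.+ k)) 0ℓ
UClass {m} b a s ε ζ c = VClass {m} a s ⊠ WClass b ε ζ c

UClass? : ∀ {m k} (b : 𝔽₃^ k) a s ε ζ c → Decidable (UClass {m} b a s ε ζ c)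
UClass? {m} b a s ε ζ c = VClass? {m} a s ⊠? WClass? b ε ζ c

{-# OPTIONS --safe #-}
module Submission where

-- Why the theorem holds.  Let ω be a primitive cube root of unity, so that
-- φ(c) = ω^c + ω^(-c) and 3[c ≠ 0] = 2 - φ(c).  Summing over x in D, and using
-- that the sum of φ(u · x) over the whole space vanishes for u ≠ 0 (∑-φ), three
-- times the weight of u is 2|D| plus the sum of φ(u · x) over the set of ideals.
-- That set is the disjoint union in Ideal-shape, so ∑-Ideal turns any sum over it
-- into a sum over the subspace w = 0, plus a sum over the copy of the box above
-- v = 𝟐, minus the term of the common point (𝟐, 𝟎).  The constant function gives
-- the length; for φ(u · x) the three terms are a full character sum, the box sum
-- ∑-box-φ, and φ(2σ) = φ(σ).
--
-- A box sum is a product over the coordinates.  A coordinate in T₁ contributes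
-- 1 + ω^(w_i), which is 2 if w_i = 0 and -ω^(2 w_i) otherwise; one in T₂
-- contributes 3 if w_i = 0 and 0 otherwise; one in T₀ contributes 1.  Only φ, and never ω itself, is
-- needed: the induction on coordinates uses φ-pair and φ-line, finite
-- identities that absorb the phase into the argument of φ.
--
-- The classes of w are counted coordinatewise too (#-W): a coordinate in T₀ is
-- free, those in T₂ are either all zero or not, and those in T₁ give the product
-- of a binomial coefficient and N by Pascal's rule and the recursion N-suc.  The
-- closed form of N is the solution 3 N c r = 2^r + (-1)^r φ(c) of that recursion.
--
-- All counts are handled as integer sums of indicators (#-∑, wt-∑) over the
-- coordinatewise sum ∑.

open import Defs
open import Data.Fin using (Fin; zero; suc; toℕ; _↑ˡ_; _↑ʳ_)
import Data.Fin as Fin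
open import Data.Fin.Patterns using (0F; 1F; 2F)
import Data.Fin.Properties as Fin
open import Data.Integer using (ℤ; +_; _+_; _-_; _*_; _^_; -_; -1ℤ; 0ℤ; 1ℤ)
import Data.Integer as ℤ
import Data.Integer.Properties as ℤ
open import Data.Integer.Tactic.RingSolver using (solve-∀)
open import Data.List using (List; []; _∷_; length; filter; map; allFin)
import Data.List as List
import Data.List.Properties as List
open import Data.List.Relation.Unary.All using (all?)
import Data.List.Relation.Unary.All as All
import Data.List.Relation.Unary.All.Properties as All
open import Data.Nat using (ℕ; zero; suc; _≤_; _<_; z≤n; _∸_)
open import Data.Nat.Combinatorics using (_C_; nCk+nC[k+1]≡[n+1]C[k+1]; k>n⇒nCk≡0)
import Data.Nat.Properties as ℕ
open import Data.Product using (_×_; _,_; proj₁; proj₂; ∃)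
open import Data.Rational using (_/_)
open import Data.Rational.Properties using (fromℚᵘ-cong)
open import Data.Rational.Unnormalised using (mkℚᵘ; *≡*)
open import Data.Sum using (_⊎_; inj₁; inj₂)
open import Data.Unit using (tt)
open import Data.Vec using ([]; _∷_; _++_; lookup; take; drop)
import Data.Vec.Properties as Vec
open import Function using (_∘_; id)
open import Relation.Binary.PropositionalEquality using (_≡_; _≢_; refl; sym; trans; cong; cong₂; subst; subst₂; module ≡-Reasoning)
open import Relation.Nullary using (Dec; yes; no; ¬_; ¬?; _×-dec_; _→-dec_; contradiction)
open import Relation.Nullary.Decidable using (from-yes)
open import Relation.Unary using (Pred; Decidable; U; ｛_｝; _≐_; _∪_; _∖_)
open import Relation.Unary.Properties using (_∩?_; ∁?)
import Data.Nat as ℕ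

open ≡-Reasoning

-- Indicators of decidable propositions

⟦⟧-yes : ∀ {p} {P : Set p} (P? : Dec P) → P → ⟦ P? ⟧ ≡ 1
⟦⟧-yes (yes _) _ = refl
⟦⟧-yes (no ¬p) p = contradiction p ¬p

⟦⟧-no : ∀ {p} {P : Set p} (P? : Dec P) → ¬ P → ⟦ P? ⟧ ≡ 0
⟦⟧-no (yes p) ¬p = contradiction p ¬p
⟦⟧-no (no _)  _  = refl

⟦⟧-cong : ∀ {p q} {P : Set p} {Q : Set q} (P? : Dec P) (Q? : Dec Q) →
          (P → Q) → (Q → P) → ⟦ P? ⟧ ≡ ⟦ Q? ⟧
⟦⟧-cong (yes p) Q? f _ = sym (⟦⟧-yes Q? (f p))
⟦⟧-cong (no ¬p) Q? _ g = sym (⟦⟧-no Q? (¬p ∘ g))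

⟦⟧-× : ∀ {p q} {P : Set p} {Q : Set q} (P? : Dec P) (Q? : Dec Q) →
       + ⟦ P? ×-dec Q? ⟧ ≡ + ⟦ P? ⟧ * + ⟦ Q? ⟧
⟦⟧-× (yes _) (yes _) = refl
⟦⟧-× (yes _) (no _)  = refl
⟦⟧-× (no _)  (yes _) = refl
⟦⟧-× (no _)  (no _)  = refl

⟦⟧-¬ : ∀ {p} {P : Set p} (P? : Dec P) → + ⟦ ¬? P? ⟧ ≡ 1ℤ - + ⟦ P? ⟧
⟦⟧-¬ (yes _) = refl
⟦⟧-¬ (no _)  = refl

-- Sums over all vectors

-- The sum of f over all vectors of length n, coordinate by coordinate.
∑ : ∀ {n} → (𝔽₃^ n → ℤ) → ℤ
∑ {zero}  f = f []
∑ {suc n} f = ∑ (λ x → f (0F ∷ x)) + ∑ (λ x → f (1F ∷ x)) + ∑ (λ x → f (2F ∷ x))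

∑-cong : ∀ {n} {f g : 𝔽₃^ n → ℤ} → (∀ x → f x ≡ g x) → ∑ f ≡ ∑ g
∑-cong {zero}  f≗g = f≗g []
∑-cong {suc n} f≗g =
  cong₂ _+_ (cong₂ _+_ (∑-cong (f≗g ∘ (0F ∷_))) (∑-cong (f≗g ∘ (1F ∷_)))) (∑-cong (f≗g ∘ (2F ∷_)))

∑-+ : ∀ {n} (f g : 𝔽₃^ n → ℤ) → ∑ (λ x → f x + g x) ≡ ∑ f + ∑ g
∑-+ {zero}  f g = refl
∑-+ {suc n} f g
  rewrite ∑-+ (f ∘ (0F ∷_)) (g ∘ (0F ∷_)) | ∑-+ (f ∘ (1F ∷_)) (g ∘ (1F ∷_)) | ∑-+ (f ∘ (2F ∷_)) (g ∘ (2F ∷_))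
  = interchange (∑ (f ∘ (0F ∷_))) (∑ (g ∘ (0F ∷_))) (∑ (f ∘ (1F ∷_))) (∑ (g ∘ (1F ∷_))) (∑ (f ∘ (2F ∷_))) (∑ (g ∘ (2F ∷_)))
  where
  interchange : ∀ a b c d x y → a + b + (c + d) + (x + y) ≡ a + c + x + (b + d + y)
  interchange = solve-∀

∑-*ˡ : ∀ {n} r (f : 𝔽₃^ n → ℤ) → ∑ (λ x → r * f x) ≡ r * ∑ f
∑-*ˡ {zero}  r f = refl
∑-*ˡ {suc n} r f
  rewrite ∑-*ˡ r (f ∘ (0F ∷_)) | ∑-*ˡ r (f ∘ (1F ∷_)) | ∑-*ˡ r (f ∘ (2F ∷_))
  = distrib r (∑ (f ∘ (0F ∷_))) (∑ (f ∘ (1F ∷_))) (∑ (f ∘ (2F ∷_)))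
  where
  distrib : ∀ r a b c → r * a + r * b + r * c ≡ r * (a + b + c)
  distrib = solve-∀

∑-- : ∀ {n} (f g : 𝔽₃^ n → ℤ) → ∑ (λ x → f x - g x) ≡ ∑ f - ∑ g
∑-- f g = begin
  ∑ (λ x → f x - g x)        ≡⟨ ∑-cong (λ x → cong (λ i → f x + i) (sym (ℤ.-1*i≡-i (g x)))) ⟩
  ∑ (λ x → f x + -1ℤ * g x)  ≡⟨ ∑-+ f _ ⟩
  ∑ f + ∑ (λ x → -1ℤ * g x)  ≡⟨ cong (λ i → ∑ f + i) (trans (∑-*ˡ -1ℤ g) (ℤ.-1*i≡-i (∑ g))) ⟩
  ∑ f - ∑ g                  ∎

∑-const : ∀ n r → ∑ {n} (λ _ → r) ≡ (+ 3) ^ n * r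
∑-const zero    r = sym (ℤ.*-identityˡ r)
∑-const (suc n) r rewrite ∑-const n r = triple ((+ 3) ^ n) r
  where
  triple : ∀ q r → q * r + q * r + q * r ≡ + 3 * q * r
  triple = solve-∀

∑-++ : ∀ m {k} (f : 𝔽₃^ (m ℕ.+ k) → ℤ) → ∑ f ≡ ∑ {m} (λ v → ∑ {k} (λ w → f (v ++ w)))
∑-++ zero    f = refl
∑-++ (suc m) f =
  cong₂ _+_ (cong₂ _+_ (∑-++ m (f ∘ (0F ∷_))) (∑-++ m (f ∘ (1F ∷_)))) (∑-++ m (f ∘ (2F ∷_)))

∑-zero : ∀ {n} {f : 𝔽₃^ n → ℤ} → (∀ x → f x ≡ 0ℤ) → ∑ f ≡ 0ℤ
∑-zero {n} f≗0 = trans (∑-cong f≗0) (trans (∑-const n 0ℤ) (ℤ.*-zeroʳ ((+ 3) ^ n)))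

∑-single : ∀ {n} (f : 𝔽₃^ n → ℤ) y → (∀ x → x ≢ y → f x ≡ 0ℤ) → ∑ f ≡ f y
∑-single f []       _ = refl
∑-single f (a ∷ y) off = pick a off
  where
  on : ∀ a → (∀ x → x ≢ a ∷ y → f x ≡ 0ℤ) → ∑ (λ x → f (a ∷ x)) ≡ f (a ∷ y)
  on a off = ∑-single (f ∘ (a ∷_)) y (λ x x≢y → off (a ∷ x) (x≢y ∘ Vec.∷-injectiveʳ))
  vanish : ∀ a {b} → (∀ x → x ≢ a ∷ y → f x ≡ 0ℤ) → b ≢ a → ∑ (λ x → f (b ∷ x)) ≡ 0ℤ
  vanish a {b} off b≢a = ∑-zero (λ x → off (b ∷ x) (b≢a ∘ Vec.∷-injectiveˡ))
  pick : ∀ a → (∀ x → x ≢ a ∷ y → f x ≡ 0ℤ) → ∑ f ≡ f (a ∷ y)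
  pick 0F off rewrite on 0F off | vanish 0F {1F} off (λ ()) | vanish 0F {2F} off (λ ()) =
    trans (ℤ.+-identityʳ _) (ℤ.+-identityʳ _)
  pick 1F off rewrite on 1F off | vanish 1F {0F} off (λ ()) | vanish 1F {2F} off (λ ()) =
    trans (ℤ.+-identityʳ _) (ℤ.+-identityˡ _)
  pick 2F off rewrite on 2F off | vanish 2F {0F} off (λ ()) | vanish 2F {1F} off (λ ()) =
    ℤ.+-identityˡ _

-- Summing against the indicator of a point evaluates there.
∑-δ : ∀ {n} (y : 𝔽₃^ n) (f : 𝔽₃^ n → ℤ) → ∑ (λ x → + ⟦ x ≟ y ⟧ * f x) ≡ f y
∑-δ y f = trans
  (∑-single _ y λ x x≢y → cong (λ i → + i * f x) (⟦⟧-no (x ≟ y) x≢y))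
  (trans (cong (λ i → + i * f y) (⟦⟧-yes (y ≟ y) refl)) (ℤ.*-identityˡ (f y)))

-- Counting as summation

filter-map : ∀ {a b p} {A : Set a} {B : Set b} {P : Pred B p} (P? : Decidable P) (f : A → B) xs →
             filter P? (map f xs) ≡ map f (filter (P? ∘ f) xs)
filter-map P? f []       = refl
filter-map P? f (x ∷ xs) with P? (f x)
... | yes _ = cong (f x ∷_) (filter-map P? f xs)
... | no  _ = filter-map P? f xs

length-filter-map : ∀ {a b p} {A : Set a} {B : Set b} {P : Pred B p} (P? : Decidable P) (f : A → B) xs →
                    length (filter P? (map f xs)) ≡ length (filter (P? ∘ f) xs)
length-filter-map P? f xs = trans (cong length (filter-map P? f xs)) (List.length-map f (filter (P? ∘ f) xs))

length-filter-filter : ∀ {a p q} {A : Set a} {P : Pred A p} {Q : Pred A q} (P? : Decidable P) (Q? : Decidable Q) xs →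
                       length (filter Q? (filter P? xs)) ≡ length (filter (P? ∩? Q?) xs)
length-filter-filter P? Q? [] = refl
length-filter-filter P? Q? (x ∷ xs) with P? x
... | no _ = length-filter-filter P? Q? xs
... | yes _ with Q? x
...   | no _  = length-filter-filter P? Q? xs
...   | yes _ = cong suc (length-filter-filter P? Q? xs)

#-suc : ∀ {n p} {P : Pred (𝔽₃^ (suc n)) p} (P? : Decidable P) →
        # P? ≡ # (P? ∘ (0F ∷_)) ℕ.+ # (P? ∘ (1F ∷_)) ℕ.+ # (P? ∘ (2F ∷_))
#-suc {n} P? = begin
  length (filter P? (s 0F List.++ s 1F List.++ s 2F List.++ []))  ≡⟨ split (s 0F) _ ⟩
  c 0F ℕ.+ length (filter P? (s 1F List.++ s 2F List.++ []))      ≡⟨ cong (c 0F ℕ.+_) (split (s 1F) _) ⟩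
  c 0F ℕ.+ (c 1F ℕ.+ length (filter P? (s 2F List.++ [])))        ≡⟨ ℕ.+-assoc (c 0F) (c 1F) _ ⟨
  c 0F ℕ.+ c 1F ℕ.+ length (filter P? (s 2F List.++ []))
    ≡⟨ cong (λ xs → c 0F ℕ.+ c 1F ℕ.+ length (filter P? xs)) (List.++-identityʳ (s 2F)) ⟩
  c 0F ℕ.+ c 1F ℕ.+ c 2F
    ≡⟨ cong₂ ℕ._+_ (cong₂ ℕ._+_ (tail 0F) (tail 1F)) (tail 2F) ⟩
  # (P? ∘ (0F ∷_)) ℕ.+ # (P? ∘ (1F ∷_)) ℕ.+ # (P? ∘ (2F ∷_))     ∎
  where
  s : 𝔽₃ → List (𝔽₃^ (suc n))
  s a = map (a ∷_) (vectors n)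
  c : 𝔽₃ → ℕ
  c a = length (filter P? (s a))
  tail : ∀ a → c a ≡ # (P? ∘ (a ∷_))
  tail a = length-filter-map P? (a ∷_) (vectors n)
  split : ∀ xs ys → length (filter P? (xs List.++ ys)) ≡ length (filter P? xs) ℕ.+ length (filter P? ys)
  split xs ys = trans (cong length (List.filter-++ P? xs ys)) (List.length-++ (filter P? xs))

#-∑ : ∀ {n p} {P : Pred (𝔽₃^ n) p} (P? : Decidable P) → + # P? ≡ ∑ (λ x → + ⟦ P? x ⟧)
#-∑ {zero}  P? with P? []
... | yes _ = refl
... | no  _ = refl
#-∑ {suc n} P? = trans (cong +_ (#-suc P?))
  (cong₂ _+_ (cong₂ _+_ (#-∑ (P? ∘ (0F ∷_))) (#-∑ (P? ∘ (1F ∷_)))) (#-∑ (P? ∘ (2F ∷_))))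

#-cong : ∀ {n p q} {P : Pred (𝔽₃^ n) p} {Q : Pred (𝔽₃^ n) q} (P? : Decidable P) (Q? : Decidable Q) →
         (∀ x → P x → Q x) → (∀ x → Q x → P x) → # P? ≡ # Q?
#-cong {n} P? Q? f g = cong length (List.filter-≐ P? Q? ((λ {x} → f x) , (λ {x} → g x)) (vectors n))

#-∅ : ∀ {n p} {P : Pred (𝔽₃^ n) p} (P? : Decidable P) → (∀ x → ¬ P x) → # P? ≡ 0
#-∅ P? ¬P = ℤ.+-injective (trans (#-∑ P?) (∑-zero λ x → cong +_ (⟦⟧-no (P? x) (¬P x))))

-- The weight of a codeword as a sum over the whole space.
wt-∑ : ∀ {n p} {P : Pred (𝔽₃^ n) p} (P? : Decidable P) u →
       + wt (codeword (elements P?) u) ≡ ∑ (λ x → + ⟦ P? x ⟧ * + ⟦ ¬? (u · x Fin.≟ 0F) ⟧)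
wt-∑ {n} P? u = begin
  + wt (map (u ·_) (filter P? (vectors n)))    ≡⟨ cong +_ (length-filter-map _ (u ·_) (elements P?)) ⟩
  + length (filter Q? (filter P? (vectors n))) ≡⟨ cong +_ (length-filter-filter P? Q? (vectors n)) ⟩
  + # (P? ∩? Q?)                               ≡⟨ #-∑ (P? ∩? Q?) ⟩
  ∑ (λ x → + ⟦ P? x ×-dec Q? x ⟧)              ≡⟨ ∑-cong (λ x → ⟦⟧-× (P? x) (Q? x)) ⟩
  ∑ (λ x → + ⟦ P? x ⟧ * + ⟦ Q? x ⟧)            ∎
  where
  Q? : Decidable (λ x → u · x ≢ 0F)
  Q? x = ¬? (u · x Fin.≟ 0F)

-- Arithmetic and characters of the field

⊕-identityˡ : ∀ a → 0F ⊕ a ≡ a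
⊕-identityˡ = from-yes (Fin.all? λ a → (0F ⊕ a) Fin.≟ a)

⊕-identityʳ : ∀ a → a ⊕ 0F ≡ a
⊕-identityʳ = from-yes (Fin.all? λ a → (a ⊕ 0F) Fin.≟ a)

⊗-zeroʳ : ∀ a → a ⊗ 0F ≡ 0F
⊗-zeroʳ = from-yes (Fin.all? λ a → (a ⊗ 0F) Fin.≟ 0F)

⊕-assoc : ∀ a b c → (a ⊕ b) ⊕ c ≡ a ⊕ (b ⊕ c)
⊕-assoc = from-yes (Fin.all? λ a → Fin.all? λ b → Fin.all? λ c → ((a ⊕ b) ⊕ c) Fin.≟ (a ⊕ (b ⊕ c)))

-- The negative of a is 2a.
⊕-solve : ∀ a b c → a ⊕ b ≡ c → b ≡ 2F ⊗ a ⊕ c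
⊕-solve = from-yes (Fin.all? λ a → Fin.all? λ b → Fin.all? λ c →
  ((a ⊕ b) Fin.≟ c) →-dec (b Fin.≟ (2F ⊗ a ⊕ c)))

⊕-unsolve : ∀ a b c → b ≡ 2F ⊗ a ⊕ c → a ⊕ b ≡ c
⊕-unsolve = from-yes (Fin.all? λ a → Fin.all? λ b → Fin.all? λ c →
  (b Fin.≟ (2F ⊗ a ⊕ c)) →-dec ((a ⊕ b) Fin.≟ c))

-- Exactly one a satisfies a + b = c.
⊕-count : ∀ b c → + ⟦ 0F ⊕ b Fin.≟ c ⟧ + + ⟦ 1F ⊕ b Fin.≟ c ⟧ + + ⟦ 2F ⊕ b Fin.≟ c ⟧ ≡ 1ℤ
⊕-count = from-yes (Fin.all? λ b → Fin.all? λ c →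
  (+ ⟦ 0F ⊕ b Fin.≟ c ⟧ + + ⟦ 1F ⊕ b Fin.≟ c ⟧ + + ⟦ 2F ⊕ b Fin.≟ c ⟧) ℤ.≟ 1ℤ)

2⊗-⊕ : ∀ a b → 2F ⊗ (a ⊕ b) ≡ 2F ⊗ a ⊕ 2F ⊗ b
2⊗-⊕ = from-yes (Fin.all? λ a → Fin.all? λ b → (2F ⊗ (a ⊕ b)) Fin.≟ (2F ⊗ a ⊕ 2F ⊗ b))

⊗2 : ∀ a → a ⊗ 2F ≡ 2F ⊗ a
⊗2 = from-yes (Fin.all? λ a → (a ⊗ 2F) Fin.≟ (2F ⊗ a))

-- Multiplication by 2 is negation, and φ(c) = ω^c + ω^(-c) is even.
φ-even : ∀ a → φ (2F ⊗ a) ≡ φ a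
φ-even = from-yes (Fin.all? λ a → φ (2F ⊗ a) ℤ.≟ φ a)

φ-indicator : ∀ c → + 3 * + ⟦ ¬? (c Fin.≟ 0F) ⟧ ≡ + 2 - φ c
φ-indicator = from-yes (Fin.all? λ c → (+ 3 * + ⟦ ¬? (c Fin.≟ 0F) ⟧) ℤ.≟ (+ 2 - φ c))

-- A nonzero multiplier suc u runs through the whole field, over which φ sums to 0.
φ-line : ∀ u a y → φ ((a ⊕ suc u ⊗ 0F) ⊕ y) + φ ((a ⊕ suc u ⊗ 1F) ⊕ y) + φ ((a ⊕ suc u ⊗ 2F) ⊕ y) ≡ 0ℤ
φ-line = from-yes (Fin.all? λ u → Fin.all? λ a → Fin.all? λ y →
  (φ ((a ⊕ suc u ⊗ 0F) ⊕ y) + φ ((a ⊕ suc u ⊗ 1F) ⊕ y) + φ ((a ⊕ suc u ⊗ 2F) ⊕ y)) ℤ.≟ 0ℤ)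

-- This is 1 + ω^b = -ω^(2b) for the nonzero element b = suc u, multiplied by
-- ω^(a + 2s) and added to its conjugate.
φ-pair : ∀ u a s → φ ((a ⊕ suc u ⊗ 0F) ⊕ 2F ⊗ s) + φ ((a ⊕ suc u ⊗ 1F) ⊕ 2F ⊗ s)
                   ≡ - φ (a ⊕ 2F ⊗ (suc u ⊕ s))
φ-pair = from-yes (Fin.all? λ u → Fin.all? λ a → Fin.all? λ s →
  (φ ((a ⊕ suc u ⊗ 0F) ⊕ 2F ⊗ s) + φ ((a ⊕ suc u ⊗ 1F) ⊕ 2F ⊗ s)) ℤ.≟ (- φ (a ⊕ 2F ⊗ (suc u ⊕ s))))

Σ𝔽₃-𝟎 : ∀ n → Σ𝔽₃ (𝟎 {n}) ≡ 0F
Σ𝔽₃-𝟎 zero    = refl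
Σ𝔽₃-𝟎 (suc n) = trans (⊕-identityˡ _) (Σ𝔽₃-𝟎 n)

·-++ : ∀ {m k} (v x : 𝔽₃^ m) (w y : 𝔽₃^ k) → (v ++ w) · (x ++ y) ≡ v · x ⊕ w · y
·-++ []      []      w y = sym (⊕-identityˡ _)
·-++ (a ∷ v) (b ∷ x) w y = trans (cong (a ⊗ b ⊕_) (·-++ v x w y)) (sym (⊕-assoc (a ⊗ b) (v · x) (w · y)))

·-𝟎 : ∀ {n} (u : 𝔽₃^ n) → u · 𝟎 ≡ 0F
·-𝟎 []      = refl
·-𝟎 (a ∷ u) = cong₂ _⊕_ (⊗-zeroʳ a) (·-𝟎 u)

·-𝟐 : ∀ {n} (u : 𝔽₃^ n) → u · 𝟐 ≡ 2F ⊗ Σ𝔽₃ u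
·-𝟐 []      = refl
·-𝟐 (a ∷ u) = trans (cong₂ _⊕_ (⊗2 a) (·-𝟐 u)) (sym (2⊗-⊕ a (Σ𝔽₃ u)))

≟𝟎-∷ : ∀ {n} (u : 𝔽₃^ n) → ⟦ 0F ∷ u ≟ 𝟎 ⟧ ≡ ⟦ u ≟ 𝟎 ⟧
≟𝟎-∷ u = ⟦⟧-cong (0F ∷ u ≟ 𝟎) (u ≟ 𝟎) Vec.∷-injectiveʳ (cong (0F ∷_))

-- Orthogonality of characters, over the whole space.
∑-φ : ∀ {n} (u : 𝔽₃^ n) a → ∑ (λ x → φ (a ⊕ u · x)) ≡ (+ 3) ^ n * + ⟦ u ≟ 𝟎 ⟧ * φ a
∑-φ []      a = trans (cong φ (⊕-identityʳ a)) (sym (ℤ.*-identityˡ (φ a)))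
∑-φ {suc n} (0F ∷ u) a rewrite ≟𝟎-∷ u = trans (cong₂ _+_ (cong₂ _+_ rest rest) rest) (triple ((+ 3) ^ n) (+ ⟦ u ≟ 𝟎 ⟧) (φ a))
  where
  triple : ∀ q i r → q * i * r + q * i * r + q * i * r ≡ + 3 * q * i * r
  triple = solve-∀
  rest : ∑ (λ x → φ (a ⊕ (0F ⊕ u · x))) ≡ (+ 3) ^ n * + ⟦ u ≟ 𝟎 ⟧ * φ a
  rest = trans (∑-cong λ x → cong (λ y → φ (a ⊕ y)) (⊕-identityˡ (u · x))) (∑-φ u a)
∑-φ {suc n} (suc b ∷ u) a = begin
  ∑ (f 0F) + ∑ (f 1F) + ∑ (f 2F)        ≡⟨ cong (_+ ∑ (f 2F)) (∑-+ (f 0F) (f 1F)) ⟨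
  ∑ (λ x → f 0F x + f 1F x) + ∑ (f 2F)  ≡⟨ ∑-+ _ (f 2F) ⟨
  ∑ (λ x → f 0F x + f 1F x + f 2F x)    ≡⟨ ∑-zero vanish ⟩
  0ℤ                                    ≡⟨ cong (_* φ a) (ℤ.*-zeroʳ ((+ 3) ^ suc n)) ⟨
  (+ 3) ^ suc n * 0ℤ * φ a              ≡⟨ cong (λ i → (+ 3) ^ suc n * + i * φ a) (⟦⟧-no (suc b ∷ u ≟ 𝟎) λ ()) ⟨
  (+ 3) ^ suc n * + ⟦ suc b ∷ u ≟ 𝟎 ⟧ * φ a  ∎
  where
  f : 𝔽₃ → 𝔽₃^ n → ℤ
  f x₀ x = φ (a ⊕ (suc b ⊗ x₀ ⊕ u · x))
  vanish : ∀ x → f 0F x + f 1F x + f 2F x ≡ 0ℤ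
  vanish x
    rewrite sym (⊕-assoc a (suc b ⊗ 0F) (u · x))
          | sym (⊕-assoc a (suc b ⊗ 1F) (u · x))
          | sym (⊕-assoc a (suc b ⊗ 2F) (u · x))
    = φ-line b a (u · x)

-- Coordinatewise recursion for the statistics of a vector

-- The first coordinate lies in T_j exactly when b₀ = j; the remaining elements
-- of T_j are those of the tail, shifted by one.
T-tail : ∀ {k} (b₀ : 𝔽₃) (b : 𝔽₃^ k) j →
         filter (λ i → lookup (b₀ ∷ b) i Fin.≟ j) (List.tabulate suc) ≡ map suc (T b j)
T-tail b₀ b j = trans
  (cong (filter (λ i → lookup (b₀ ∷ b) i Fin.≟ j)) (sym (List.map-tabulate id suc)))
  (filter-map (λ i → lookup (b₀ ∷ b) i Fin.≟ j) suc (allFin _))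

T-here : ∀ {k} (b : 𝔽₃^ k) j → T (j ∷ b) j ≡ zero ∷ map suc (T b j)
T-here b j = trans (List.filter-accept (λ i → lookup (j ∷ b) i Fin.≟ j) {x = zero} refl)
                   (cong (zero ∷_) (T-tail j b j))

T-there : ∀ {k} {b₀ : 𝔽₃} (b : 𝔽₃^ k) {j} → b₀ ≢ j → T (b₀ ∷ b) j ≡ map suc (T b j)
T-there {b₀ = b₀} b {j} b₀≢j = trans (List.filter-reject (λ i → lookup (b₀ ∷ b) i Fin.≟ j) {x = zero} b₀≢j)
                                     (T-tail b₀ b j)

t-here : ∀ {k} (b : 𝔽₃^ k) j → t (j ∷ b) j ≡ suc (t b j)
t-here b j = trans (cong length (T-here b j)) (cong suc (List.length-map suc (T b j)))

t-there : ∀ {k} (b₀ : 𝔽₃) (b : 𝔽₃^ k) {j} → b₀ ≢ j → t (b₀ ∷ b) j ≡ t b j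
t-there b₀ b {j} b₀≢j = trans (cong length (T-there b b₀≢j)) (List.length-map suc (T b j))

t-total : ∀ {k} (b : 𝔽₃^ k) → k ≡ t b 1F ℕ.+ (t b 2F ℕ.+ t b 0F)
t-total [] = refl
t-total (0F ∷ b) = trans (cong suc (t-total b)) (sym (trans
  (cong₂ ℕ._+_ (t-there 0F b λ ()) (trans (cong₂ ℕ._+_ (t-there 0F b λ ()) (t-here b 0F)) (ℕ.+-suc (t b 2F) (t b 0F))))
  (ℕ.+-suc (t b 1F) (t b 2F ℕ.+ t b 0F))))
t-total (1F ∷ b) = trans (cong suc (t-total b)) (sym
  (cong₂ ℕ._+_ (t-here b 1F) (cong₂ ℕ._+_ (t-there 1F b λ ()) (t-there 1F b λ ()))))
t-total (2F ∷ b) = trans (cong suc (t-total b)) (sym (trans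
  (cong₂ ℕ._+_ (t-there 2F b λ ()) (cong₂ ℕ._+_ (t-here b 2F) (t-there 2F b λ ())))
  (ℕ.+-suc (t b 1F) (t b 2F ℕ.+ t b 0F))))

t₀-∸ : ∀ {k} (b : 𝔽₃^ k) → k ∸ t b 1F ∸ t b 2F ≡ t b 0F
t₀-∸ b = trans
  (cong (λ i → i ∸ t b 1F ∸ t b 2F) (t-total b))
  (trans (cong (_∸ t b 2F) (ℕ.m+n∸m≡n (t b 1F) (t b 2F ℕ.+ t b 0F))) (ℕ.m+n∸m≡n (t b 2F) (t b 0F)))

-- Effect of a new first coordinate: -there if it lies outside the relevant T_j,
-- and otherwise -j-0 or -j-suc according as the entry of w is zero or not.
module _ {k} (b w : 𝔽₃^ k) where

  z≤t₁ : z b w ≤ t b 1F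
  z≤t₁ = List.length-filter (λ i → lookup w i Fin.≟ 0F) (T b 1F)

  private
    -- The number of positions in a list at which x vanishes.
    zeros : ∀ {j} → 𝔽₃^ j → List (Fin j) → ℕ
    zeros x is = length (filter (λ i → lookup x i Fin.≟ 0F) is)

    shift : ∀ a is → zeros (a ∷ w) (map suc is) ≡ zeros w is
    shift a = length-filter-map (λ i → lookup (a ∷ w) i Fin.≟ 0F) suc

  z-there : ∀ b₀ a → b₀ ≢ 1F → z (b₀ ∷ b) (a ∷ w) ≡ z b w
  z-there b₀ a b₀≢1 = trans (cong (zeros (a ∷ w)) (T-there b b₀≢1)) (shift a (T b 1F))

  z-1-0 : z (1F ∷ b) (0F ∷ w) ≡ suc (z b w)
  z-1-0 = trans (cong (zeros (0F ∷ w)) (T-here b 1F)) (cong suc (shift 0F (T b 1F)))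

  z-1-suc : ∀ a → z (1F ∷ b) (suc a ∷ w) ≡ z b w
  z-1-suc a = trans (cong (zeros (suc a ∷ w)) (T-here b 1F)) (shift (suc a) (T b 1F))

  o-there : ∀ b₀ a → b₀ ≢ 1F → o (b₀ ∷ b) (a ∷ w) ≡ o b w
  o-there b₀ a b₀≢1 = cong₂ _∸_ (t-there b₀ b b₀≢1) (z-there b₀ a b₀≢1)

  o-1-0 : o (1F ∷ b) (0F ∷ w) ≡ o b w
  o-1-0 = cong₂ _∸_ (t-here b 1F) z-1-0

  o-1-suc : ∀ a → o (1F ∷ b) (suc a ∷ w) ≡ suc (o b w)
  o-1-suc a = trans (cong₂ _∸_ (t-here b 1F) (z-1-suc a)) (ℕ.+-∸-assoc 1 z≤t₁)

  s₁-there : ∀ b₀ a → b₀ ≢ 1F → s₁ (b₀ ∷ b) (a ∷ w) ≡ s₁ b w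
  s₁-there b₀ a b₀≢1 = trans
    (cong (List.foldr _⊕_ 0F ∘ map (lookup (a ∷ w))) (T-there b b₀≢1))
    (cong (List.foldr _⊕_ 0F) (sym (List.map-∘ (T b 1F))))

  s₁-1 : ∀ a → s₁ (1F ∷ b) (a ∷ w) ≡ a ⊕ s₁ b w
  s₁-1 a = trans
    (cong (List.foldr _⊕_ 0F ∘ map (lookup (a ∷ w))) (T-here b 1F))
    (cong (λ xs → a ⊕ List.foldr _⊕_ 0F xs) (sym (List.map-∘ (T b 1F))))

  private
    -- Whether x vanishes at all positions of a list.
    allZero? : ∀ {j} (x : 𝔽₃^ j) (is : List (Fin j)) → Dec (All.All (λ i → lookup x i ≡ 0F) is)
    allZero? x = all? (λ i → lookup x i Fin.≟ 0F)

  e-there : ∀ b₀ a → b₀ ≢ 2F → e (b₀ ∷ b) (a ∷ w) ≡ e b w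
  e-there b₀ a b₀≢2 = trans
    (cong (λ is → ⟦ allZero? (a ∷ w) is ⟧) (T-there b b₀≢2))
    (⟦⟧-cong (allZero? (a ∷ w) (map suc (T b 2F))) (allZero? w (T b 2F)) All.map⁻ All.map⁺)

  e-2-0 : e (2F ∷ b) (0F ∷ w) ≡ e b w
  e-2-0 = trans
    (cong (λ is → ⟦ allZero? (0F ∷ w) is ⟧) (T-here b 2F))
    (⟦⟧-cong (allZero? (0F ∷ w) (zero ∷ map suc (T b 2F))) (allZero? w (T b 2F))
             (All.map⁻ ∘ All.tail) (λ p → refl All.∷ All.map⁺ p))

  e-2-suc : ∀ a → e (2F ∷ b) (suc a ∷ w) ≡ 0
  e-2-suc a = trans
    (cong (λ is → ⟦ allZero? (suc a ∷ w) is ⟧) (T-here b 2F))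
    (⟦⟧-no (allZero? (suc a ∷ w) (zero ∷ map suc (T b 2F))) (λ { (() All.∷ _) }))

  e-bit : e b w ≡ 0 ⊎ e b w ≡ 1
  e-bit with all? (λ i → lookup w i Fin.≟ 0F) (T b 2F)
  ... | yes _ = inj₂ refl
  ... | no  _ = inj₁ refl

-- Sums over a box

-- The indicator of a ≤ b₀ as integers.
below : 𝔽₃ → 𝔽₃ → ℤ
below a b₀ = + ⟦ a Fin.≤? b₀ ⟧

⊑-∷ : ∀ {k} (a b₀ : 𝔽₃) (x b : 𝔽₃^ k) → + ⟦ (a ∷ x) ⊑? (b₀ ∷ b) ⟧ ≡ below a b₀ * + ⟦ x ⊑? b ⟧
⊑-∷ a b₀ x b = trans
  (cong +_ (⟦⟧-cong ((a ∷ x) ⊑? (b₀ ∷ b)) ((a Fin.≤? b₀) ×-dec (x ⊑? b))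
    (λ le → le zero , le ∘ suc)
    (λ { (le , _) zero → le ; (_ , le) (suc i) → le i })))
  (⟦⟧-× (a Fin.≤? b₀) (x ⊑? b))

-- A sum over a box is a sum over the values of its first coordinate.
∑-box-∷ : ∀ {k} b₀ (b : 𝔽₃^ k) (f : 𝔽₃^ (suc k) → ℤ) →
          ∑ (λ x → + ⟦ x ⊑? (b₀ ∷ b) ⟧ * f x) ≡
          below 0F b₀ * ∑ (λ x → + ⟦ x ⊑? b ⟧ * f (0F ∷ x))
          + below 1F b₀ * ∑ (λ x → + ⟦ x ⊑? b ⟧ * f (1F ∷ x))
          + below 2F b₀ * ∑ (λ x → + ⟦ x ⊑? b ⟧ * f (2F ∷ x))
∑-box-∷ b₀ b f = cong₂ _+_ (cong₂ _+_ (branch 0F) (branch 1F)) (branch 2F)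
  where
  branch : ∀ a → ∑ (λ x → + ⟦ (a ∷ x) ⊑? (b₀ ∷ b) ⟧ * f (a ∷ x)) ≡
                 below a b₀ * ∑ (λ x → + ⟦ x ⊑? b ⟧ * f (a ∷ x))
  branch a = trans
    (∑-cong λ x → trans (cong (_* f (a ∷ x)) (⊑-∷ a b₀ x b))
                        (ℤ.*-assoc (below a b₀) (+ ⟦ x ⊑? b ⟧) (f (a ∷ x))))
    (∑-*ˡ (below a b₀) (λ x → + ⟦ x ⊑? b ⟧ * f (a ∷ x)))

-- The size of a box.
∑-box-1 : ∀ {k} (b : 𝔽₃^ k) → ∑ (λ x → + ⟦ x ⊑? b ⟧ * 1ℤ) ≡ (+ 2) ^ t b 1F * (+ 3) ^ t b 2F
∑-box-1 [] = refl
∑-box-1 (b₀ ∷ b) = trans (∑-box-∷ b₀ b (λ _ → 1ℤ)) (trans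
  (cong (λ S → below 0F b₀ * S + below 1F b₀ * S + below 2F b₀ * S) (∑-box-1 b))
  (step b₀))
  where
  p q : ℤ
  p = (+ 2) ^ t b 1F
  q = (+ 3) ^ t b 2F
  powers : ∀ {i i′ j j′} → i ≡ i′ → j ≡ j′ → (+ 2) ^ i * (+ 3) ^ j ≡ (+ 2) ^ i′ * (+ 3) ^ j′
  powers = cong₂ (λ i j → (+ 2) ^ i * (+ 3) ^ j)
  one : ∀ p q → 1ℤ * (p * q) + 0ℤ * (p * q) + 0ℤ * (p * q) ≡ p * q
  one = solve-∀
  two : ∀ p q → 1ℤ * (p * q) + 1ℤ * (p * q) + 0ℤ * (p * q) ≡ + 2 * p * q
  two = solve-∀
  three : ∀ p q → 1ℤ * (p * q) + 1ℤ * (p * q) + 1ℤ * (p * q) ≡ p * (+ 3 * q)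
  three = solve-∀
  step : ∀ b₀ → below 0F b₀ * (p * q) + below 1F b₀ * (p * q) + below 2F b₀ * (p * q)
              ≡ (+ 2) ^ t (b₀ ∷ b) 1F * (+ 3) ^ t (b₀ ∷ b) 2F
  step 0F = trans (one p q) (sym (powers (t-there 0F b λ ()) (t-there 0F b λ ())))
  step 1F = trans (two p q) (sym (powers (t-here b 1F) (t-there 1F b λ ())))
  step 2F = trans (three p q) (sym (powers (t-there 2F b λ ()) (t-here b 2F)))

-- The value of the character sum over a box, as a function of t₂, e(w), z(w),
-- o(w), and the argument of φ.
boxValue : ℕ → ℕ → ℕ → ℕ → 𝔽₃ → ℤ
boxValue t₂ ε ζ ω y = (+ 3) ^ t₂ * + ε * (+ 2) ^ ζ * -1ℤ ^ ω * φ y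

boxValue-cong : ∀ {t₂ t₂′ ε ε′ ζ ζ′ ω ω′ y y′} → t₂ ≡ t₂′ → ε ≡ ε′ → ζ ≡ ζ′ → ω ≡ ω′ → y ≡ y′ →
                boxValue t₂ ε ζ ω y ≡ boxValue t₂′ ε′ ζ′ ω′ y′
boxValue-cong refl refl refl refl refl = refl

-- The character sum over a box, shifted by a.
∑-box-φ : ∀ {k} (b w : 𝔽₃^ k) a →
          ∑ (λ x → + ⟦ x ⊑? b ⟧ * φ (a ⊕ w · x)) ≡ boxValue (t b 2F) (e b w) (z b w) (o b w) (a ⊕ 2F ⊗ s₁ b w)
∑-box-φ []       []       a = refl
∑-box-φ (b₀ ∷ b) (w₀ ∷ w) a = begin
  ∑ (λ x → + ⟦ x ⊑? (b₀ ∷ b) ⟧ * φ (a ⊕ (w₀ ∷ w) · x))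
    ≡⟨ ∑-box-∷ b₀ b (λ x → φ (a ⊕ (w₀ ∷ w) · x)) ⟩
  below 0F b₀ * S 0F + below 1F b₀ * S 1F + below 2F b₀ * S 2F
    ≡⟨ cong₂ _+_ (cong₂ _+_ (cong (below 0F b₀ *_) (S-F 0F)) (cong (below 1F b₀ *_) (S-F 1F)))
                 (cong (below 2F b₀ *_) (S-F 2F)) ⟩
  below 0F b₀ * (K * F w₀ 0F) + below 1F b₀ * (K * F w₀ 1F) + below 2F b₀ * (K * F w₀ 2F)
    ≡⟨ step b₀ w₀ ⟩
  boxValue (t (b₀ ∷ b) 2F) (e (b₀ ∷ b) (w₀ ∷ w)) (z (b₀ ∷ b) (w₀ ∷ w)) (o (b₀ ∷ b) (w₀ ∷ w)) (a ⊕ 2F ⊗ s₁ (b₀ ∷ b) (w₀ ∷ w)) ∎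
  where
  q i p r K G : ℤ
  q = (+ 3) ^ t b 2F
  i = + e b w
  p = (+ 2) ^ z b w
  r = -1ℤ ^ o b w
  K = q * i * p * r
  arg : 𝔽₃ → 𝔽₃
  arg s = a ⊕ 2F ⊗ s
  G = φ (arg (s₁ b w))
  F : 𝔽₃ → 𝔽₃ → ℤ
  F w₀ x₀ = φ ((a ⊕ w₀ ⊗ x₀) ⊕ 2F ⊗ s₁ b w)
  S : 𝔽₃ → ℤ
  S x₀ = ∑ (λ x → + ⟦ x ⊑? b ⟧ * φ (a ⊕ (w₀ ⊗ x₀ ⊕ w · x)))
  S-F : ∀ x₀ → S x₀ ≡ K * F w₀ x₀
  S-F x₀ = trans
    (∑-cong λ x → cong (λ y → + ⟦ x ⊑? b ⟧ * φ y) (sym (⊕-assoc a (w₀ ⊗ x₀) (w · x))))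
    (∑-box-φ b w (a ⊕ w₀ ⊗ x₀))
  F-0 : ∀ w₀ x₀ → w₀ ⊗ x₀ ≡ 0F → F w₀ x₀ ≡ G
  F-0 w₀ x₀ eq rewrite eq | ⊕-identityʳ a = refl
  first : ∀ K x y z → 1ℤ * (K * x) + 0ℤ * (K * y) + 0ℤ * (K * z) ≡ K * x
  first = solve-∀
  double : ∀ q i p r x → 1ℤ * (q * i * p * r * x) + 1ℤ * (q * i * p * r * x) + 0ℤ * (q * i * p * r * x)
                         ≡ q * i * (+ 2 * p) * r * x
  double = solve-∀
  collect₂ : ∀ K x y z → 1ℤ * (K * x) + 1ℤ * (K * y) + 0ℤ * (K * z) ≡ K * (x + y)
  collect₂ = solve-∀
  flip : ∀ q i p r x → q * i * p * r * (- x) ≡ q * i * p * (-1ℤ * r) * x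
  flip = solve-∀
  triple : ∀ q i p r x → 1ℤ * (q * i * p * r * x) + 1ℤ * (q * i * p * r * x) + 1ℤ * (q * i * p * r * x)
                       ≡ + 3 * q * i * p * r * x
  triple = solve-∀
  collect₃ : ∀ K x y z → 1ℤ * (K * x) + 1ℤ * (K * y) + 1ℤ * (K * z) ≡ K * (x + y + z)
  collect₃ = solve-∀
  cancel : ∀ K q p r x → K * 0ℤ ≡ q * 0ℤ * p * r * x
  cancel = solve-∀
  step : ∀ b₀ w₀ → below 0F b₀ * (K * F w₀ 0F) + below 1F b₀ * (K * F w₀ 1F)
                     + below 2F b₀ * (K * F w₀ 2F)
                   ≡ boxValue (t (b₀ ∷ b) 2F) (e (b₀ ∷ b) (w₀ ∷ w)) (z (b₀ ∷ b) (w₀ ∷ w)) (o (b₀ ∷ b) (w₀ ∷ w)) (a ⊕ 2F ⊗ s₁ (b₀ ∷ b) (w₀ ∷ w))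
  step 0F w₀ = trans
    (trans (cong (λ x → 1ℤ * (K * x) + 0ℤ * (K * F w₀ 1F) + 0ℤ * (K * F w₀ 2F)) (F-0 w₀ 0F (⊗-zeroʳ w₀)))
           (first K G (F w₀ 1F) (F w₀ 2F)))
    (sym (boxValue-cong (t-there 0F b λ ()) (e-there b w 0F w₀ λ ()) (z-there b w 0F w₀ λ ()) (o-there b w 0F w₀ λ ())
                        (cong arg (s₁-there b w 0F w₀ λ ()))))
  step 1F 0F = trans
    (trans (cong (λ x → 1ℤ * (K * x) + 1ℤ * (K * x) + 0ℤ * (K * x)) (F-0 0F 0F refl)) (double q i p r G))
    (sym (boxValue-cong (t-there 1F b λ ()) (e-there b w 1F 0F λ ()) (z-1-0 b w) (o-1-0 b w)
                        (cong arg (trans (s₁-1 b w 0F) (⊕-identityˡ (s₁ b w))))))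
  step 1F (suc u) = trans
    (trans (collect₂ K (F (suc u) 0F) (F (suc u) 1F) (F (suc u) 2F))
           (trans (cong (K *_) (φ-pair u a (s₁ b w))) (flip q i p r (φ (arg (suc u ⊕ s₁ b w))))))
    (sym (boxValue-cong (t-there 1F b λ ()) (e-there b w 1F (suc u) λ ()) (z-1-suc b w u) (o-1-suc b w u)
                        (cong arg (s₁-1 b w (suc u)))))
  step 2F 0F = trans
    (trans (cong (λ x → 1ℤ * (K * x) + 1ℤ * (K * x) + 1ℤ * (K * x)) (F-0 0F 0F refl)) (triple q i p r G))
    (sym (boxValue-cong (t-here b 2F) (e-2-0 b w) (z-there b w 2F 0F λ ()) (o-there b w 2F 0F λ ())
                        (cong arg (s₁-there b w 2F 0F λ ()))))
  step 2F (suc u) = trans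
    (trans (collect₃ K (F (suc u) 0F) (F (suc u) 1F) (F (suc u) 2F))
           (trans (cong (K *_) (φ-line u a (2F ⊗ s₁ b w))) (cancel K (+ 3 * q) p r G)))
    (sym (boxValue-cong (t-here b 2F) (e-2-suc b w u) (z-there b w 2F (suc u) λ ()) (o-there b w 2F (suc u) λ ())
                        (cong arg (s₁-there b w 2F (suc u) λ ()))))

-- Vectors with full support and prescribed sum

-- The property counted by N.
N? : ∀ c r → Decidable {A = 𝔽₃^ r} (λ x → (∀ i → Supp x i) × Σ𝔽₃ x ≡ c)
N? c r x = Fin.all? (Supp? x) ×-dec (Σ𝔽₃ x Fin.≟ c)

-- The first coordinate is 1 or 2.
N-suc : ∀ c r → N c (suc r) ≡ N (2F ⊕ c) r ℕ.+ N (1F ⊕ c) r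
N-suc c r = begin
  N c (suc r)                           ≡⟨ #-suc (N? c (suc r)) ⟩
  # (N? c (suc r) ∘ (0F ∷_)) ℕ.+ # (N? c (suc r) ∘ (1F ∷_)) ℕ.+ # (N? c (suc r) ∘ (2F ∷_))
    ≡⟨ cong₂ ℕ._+_ (cong₂ ℕ._+_ (#-∅ (N? c (suc r) ∘ (0F ∷_)) λ { x (full , _) → full zero refl }) (branch 0F)) (branch 1F) ⟩
  N (2F ⊕ c) r ℕ.+ N (1F ⊕ c) r         ∎
  where
  branch : ∀ (a : Fin 2) → # (N? c (suc r) ∘ (suc a ∷_)) ≡ N (2F ⊗ suc a ⊕ c) r
  branch a = #-cong (N? c (suc r) ∘ (suc a ∷_)) (N? (2F ⊗ suc a ⊕ c) r)
    (λ { x (full , eq) → full ∘ suc , ⊕-solve (suc a) (Σ𝔽₃ x) c eq })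
    (λ { x (full , eq) → (λ { zero () ; (suc i) → full i }) , ⊕-unsolve (suc a) (Σ𝔽₃ x) c eq })

φ-shifts : ∀ c → φ (2F ⊕ c) + φ (1F ⊕ c) ≡ - φ c
φ-shifts = from-yes (Fin.all? λ c → (φ (2F ⊕ c) + φ (1F ⊕ c)) ℤ.≟ (- φ c))

-- By inversion over the characters of the field: the trivial one contributes
-- 2^r, and the two others together contribute (-1)^r φ(c).
N-closed : ∀ c r → + N c r * + 3 ≡ (+ 2) ^ r + φ c * -1ℤ ^ r
N-closed 0F zero = refl
N-closed 1F zero = refl
N-closed 2F zero = refl
N-closed c (suc r) = begin
  + N c (suc r) * + 3                                ≡⟨ cong (λ i → + i * + 3) (N-suc c r) ⟩
  (+ N (2F ⊕ c) r + + N (1F ⊕ c) r) * + 3            ≡⟨ ℤ.*-distribʳ-+ (+ 3) (+ N (2F ⊕ c) r) (+ N (1F ⊕ c) r) ⟩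
  + N (2F ⊕ c) r * + 3 + + N (1F ⊕ c) r * + 3        ≡⟨ cong₂ _+_ (N-closed (2F ⊕ c) r) (N-closed (1F ⊕ c) r) ⟩
  (p + φ (2F ⊕ c) * q) + (p + φ (1F ⊕ c) * q)        ≡⟨ collect p q (φ (2F ⊕ c)) (φ (1F ⊕ c)) ⟩
  + 2 * p + (φ (2F ⊕ c) + φ (1F ⊕ c)) * q            ≡⟨ cong (λ i → + 2 * p + i * q) (φ-shifts c) ⟩
  + 2 * p + (- φ c) * q                              ≡⟨ flip p q (φ c) ⟩
  + 2 * p + φ c * (-1ℤ * q)                          ∎
  where
  p q : ℤ
  p = (+ 2) ^ r
  q = -1ℤ ^ r
  collect : ∀ p q x y → (p + x * q) + (p + y * q) ≡ + 2 * p + (x + y) * q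
  collect = solve-∀
  flip : ∀ p q x → + 2 * p + (- x) * q ≡ + 2 * p + x * (-1ℤ * q)
  flip = solve-∀

-- Classes of v

-- Having a prescribed coordinate sum.
Σ? : ∀ {m} s → Decidable {A = 𝔽₃^ m} (λ v → Σ𝔽₃ v ≡ s)
Σ? s v = Σ𝔽₃ v Fin.≟ s

-- The other coordinates determine the first one.
#-Σ : ∀ m s → + # (Σ? {suc m} s) ≡ (+ 3) ^ m
#-Σ m s = begin
  + # (Σ? {suc m} s)                      ≡⟨ #-∑ (Σ? {suc m} s) ⟩
  ∑ (f 0F) + ∑ (f 1F) + ∑ (f 2F)          ≡⟨ cong (_+ ∑ (f 2F)) (∑-+ (f 0F) (f 1F)) ⟨
  ∑ (λ x → f 0F x + f 1F x) + ∑ (f 2F)    ≡⟨ ∑-+ (λ x → f 0F x + f 1F x) (f 2F) ⟨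
  ∑ (λ x → f 0F x + f 1F x + f 2F x)      ≡⟨ ∑-cong {m} (λ x → ⊕-count (Σ𝔽₃ x) s) ⟩
  ∑ {m} (λ _ → 1ℤ)                        ≡⟨ ∑-const m 1ℤ ⟩
  (+ 3) ^ m * 1ℤ                          ≡⟨ ℤ.*-identityʳ ((+ 3) ^ m) ⟩
  (+ 3) ^ m                               ∎
  where
  f : 𝔽₃ → 𝔽₃^ m → ℤ
  f a x = + ⟦ Σ? s (a ∷ x) ⟧

-- Only v = 0 lies in this class.
#-V₁ : ∀ m → # (VClass? {m} 1 0F) ≡ 1
#-V₁ m = ℤ.+-injective (begin
  + # (VClass? {m} 1 0F)                ≡⟨ #-∑ (VClass? {m} 1 0F) ⟩
  ∑ (λ v → + ⟦ VClass? {m} 1 0F v ⟧)    ≡⟨ ∑-single _ 𝟎 (λ v v≢𝟎 → cong +_ (⟦⟧-no (VClass? {m} 1 0F v) (off v v≢𝟎))) ⟩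
  + ⟦ VClass? {m} 1 0F 𝟎 ⟧              ≡⟨ cong +_ (⟦⟧-yes (VClass? {m} 1 0F 𝟎) (⟦⟧-yes (𝟎 {m} ≟ 𝟎) refl , Σ𝔽₃-𝟎 m)) ⟩
  1ℤ                                    ∎)
  where
  off : ∀ v → v ≢ 𝟎 → ¬ VClass {m} 1 0F v
  off v v≢𝟎 (eq , _) = ℕ.0≢1+n (trans (sym (⟦⟧-no (v ≟ 𝟎) v≢𝟎)) eq)

-- The zero vector has coordinate sum 0, so it is discarded only for s = 0.
#-V₀ : ∀ m s → + # (VClass? {suc m} 0 s) ≡ (+ 3) ^ m - + ⟦ 0F Fin.≟ s ⟧
#-V₀ m s = begin
  + # (VClass? {suc m} 0 s)               ≡⟨ #-∑ (VClass? {suc m} 0 s) ⟩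
  ∑ (λ v → + ⟦ VClass? {suc m} 0 s v ⟧)   ≡⟨ ∑-cong split ⟩
  ∑ (λ v → f v - g v)                     ≡⟨ ∑-- f g ⟩
  ∑ f - ∑ g
    ≡⟨ cong₂ _-_ (trans (sym (#-∑ (Σ? {suc m} s))) (#-Σ m s)) (∑-δ {suc m} 𝟎 (λ _ → + ⟦ 0F Fin.≟ s ⟧)) ⟩
  (+ 3) ^ m - + ⟦ 0F Fin.≟ s ⟧            ∎
  where
  f g : 𝔽₃^ (suc m) → ℤ
  f v = + ⟦ Σ? s v ⟧
  g v = + ⟦ v ≟ 𝟎 ⟧ * + ⟦ 0F Fin.≟ s ⟧
  split : ∀ v → + ⟦ VClass? {suc m} 0 s v ⟧ ≡ + ⟦ Σ? s v ⟧ - + ⟦ v ≟ 𝟎 ⟧ * + ⟦ 0F Fin.≟ s ⟧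
  split v = trans (⟦⟧-× (⟦ v ≟ 𝟎 ⟧ ℕ.≟ 0) (Σ? s v)) (cases (v ≟ 𝟎))
    where
    cases : (v≟𝟎 : Dec (v ≡ 𝟎)) → + ⟦ ⟦ v≟𝟎 ⟧ ℕ.≟ 0 ⟧ * + ⟦ Σ? s v ⟧ ≡ + ⟦ Σ? s v ⟧ - + ⟦ v≟𝟎 ⟧ * + ⟦ 0F Fin.≟ s ⟧
    cases (yes refl) = trans (vanish (+ ⟦ 0F Fin.≟ s ⟧))
      (cong (λ σ → + ⟦ σ Fin.≟ s ⟧ - 1ℤ * + ⟦ 0F Fin.≟ s ⟧) (sym (Σ𝔽₃-𝟎 (suc m))))
      where
      vanish : ∀ x → 0ℤ ≡ x - 1ℤ * x
      vanish = solve-∀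
    cases (no _) = keep (+ ⟦ Σ? s v ⟧) (+ ⟦ 0F Fin.≟ s ⟧)
      where
      keep : ∀ x y → 1ℤ * x ≡ x - 0ℤ * y
      keep = solve-∀

-- Classes of w

-- The number of ways to choose ζ of t₁ coordinates to be zero and the others
-- to be nonzero with sum c.
binomialN : ℕ → ℕ → 𝔽₃ → ℤ
binomialN t₁ ζ c = + (t₁ C ζ) * + N c (t₁ ∸ ζ)

binomialN-suc-0 : ∀ t₁ c → binomialN (suc t₁) 0 c ≡ binomialN t₁ 0 (2F ⊕ c) + binomialN t₁ 0 (1F ⊕ c)
binomialN-suc-0 t₁ c = trans
  (cong (λ i → 1ℤ * + i) (N-suc c t₁))
  (ℤ.*-distribˡ-+ 1ℤ (+ N (2F ⊕ c) t₁) (+ N (1F ⊕ c) t₁))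

-- Pascal's rule, according to whether the new coordinate is zero.
binomialN-suc-suc : ∀ t₁ ζ c → binomialN (suc t₁) (suc ζ) c ≡
                    binomialN t₁ ζ c + binomialN t₁ (suc ζ) (2F ⊕ c) + binomialN t₁ (suc ζ) (1F ⊕ c)
binomialN-suc-suc t₁ ζ c = begin
  + (suc t₁ C suc ζ) * n                ≡⟨ cong (λ i → + i * n) (nCk+nC[k+1]≡[n+1]C[k+1] t₁ ζ) ⟨
  (+ (t₁ C ζ) + + (t₁ C suc ζ)) * n     ≡⟨ ℤ.*-distribʳ-+ n (+ (t₁ C ζ)) (+ (t₁ C suc ζ)) ⟩
  + (t₁ C ζ) * n + + (t₁ C suc ζ) * n   ≡⟨ cong (λ i → + (t₁ C ζ) * n + i) (last (suc ζ ℕ.≤? t₁)) ⟩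
  + (t₁ C ζ) * n + (binomialN t₁ (suc ζ) (2F ⊕ c) + binomialN t₁ (suc ζ) (1F ⊕ c))
    ≡⟨ ℤ.+-assoc (+ (t₁ C ζ) * n) (binomialN t₁ (suc ζ) (2F ⊕ c)) (binomialN t₁ (suc ζ) (1F ⊕ c)) ⟨
  + (t₁ C ζ) * n + binomialN t₁ (suc ζ) (2F ⊕ c) + binomialN t₁ (suc ζ) (1F ⊕ c) ∎
  where
  n : ℤ
  n = + N c (t₁ ∸ ζ)
  -- For ζ ≥ t₁ the truncated difference is no longer a predecessor, but then the
  -- binomial coefficient vanishes.
  last : Dec (suc ζ ≤ t₁) → + (t₁ C suc ζ) * n ≡ binomialN t₁ (suc ζ) (2F ⊕ c) + binomialN t₁ (suc ζ) (1F ⊕ c)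
  last (yes ζ<t₁) = trans
    (cong (λ i → + (t₁ C suc ζ) * + i) (trans (cong (N c) (ℕ.+-∸-assoc 1 ζ<t₁)) (N-suc c (t₁ ∸ suc ζ))))
    (ℤ.*-distribˡ-+ (+ (t₁ C suc ζ)) (+ N (2F ⊕ c) (t₁ ∸ suc ζ)) (+ N (1F ⊕ c) (t₁ ∸ suc ζ)))
  last (no ζ≮t₁) rewrite k>n⇒nCk≡0 (ℕ.≰⇒> ζ≮t₁) = refl

-- The number of ways to choose the coordinates in T₂ so that e(w) = ε.
bitCount : ℕ → ℕ → ℤ
bitCount t₂ ε = + ⟦ ε ℕ.≟ 1 ⟧ + ((+ 3) ^ t₂ - 1ℤ) * + ⟦ ε ℕ.≟ 0 ⟧

-- The size of a class of w: a T₂ part, a T₁ part, and the t₀ free coordinates.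
wCount : ℕ → ℕ → ℕ → ℕ → ℕ → 𝔽₃ → ℤ
wCount t₀ t₁ t₂ ε ζ c = bitCount t₂ ε * binomialN t₁ ζ c * (+ 3) ^ t₀

wCount-cong : ∀ {t₀ t₀′ t₁ t₁′ t₂ t₂′} ε ζ c → t₀ ≡ t₀′ → t₁ ≡ t₁′ → t₂ ≡ t₂′ →
              wCount t₀ t₁ t₂ ε ζ c ≡ wCount t₀′ t₁′ t₂′ ε ζ c
wCount-cong _ _ _ refl refl refl = refl

-- A count splits according to the value of a function with values 0 and 1.
#-split : ∀ {n p} {P : Pred (𝔽₃^ n) p} (P? : Decidable P) (f : 𝔽₃^ n → ℕ) → (∀ x → f x ≡ 0 ⊎ f x ≡ 1) →
          + # P? ≡ + # (λ x → (f x ℕ.≟ 0) ×-dec P? x) + + # (λ x → (f x ℕ.≟ 1) ×-dec P? x)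
#-split {P = P} P? f bit = begin
  + # P?                                                         ≡⟨ #-∑ P? ⟩
  ∑ (λ x → + ⟦ P? x ⟧)                                           ≡⟨ ∑-cong split ⟩
  ∑ (λ x → + ⟦ F? 0 x ⟧ + + ⟦ F? 1 x ⟧)                          ≡⟨ ∑-+ (λ x → + ⟦ F? 0 x ⟧) (λ x → + ⟦ F? 1 x ⟧) ⟩
  ∑ (λ x → + ⟦ F? 0 x ⟧) + ∑ (λ x → + ⟦ F? 1 x ⟧)                ≡⟨ cong₂ _+_ (#-∑ (F? 0)) (#-∑ (F? 1)) ⟨
  + # (F? 0) + + # (F? 1)                                        ∎
  where
  F? : ∀ ε → Decidable (λ x → f x ≡ ε × P x)
  F? ε x = (f x ℕ.≟ ε) ×-dec P? x
  split : ∀ x → + ⟦ P? x ⟧ ≡ + ⟦ F? 0 x ⟧ + + ⟦ F? 1 x ⟧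
  split x = trans (values (f x) (bit x)) (sym (cong₂ _+_ (⟦⟧-× (f x ℕ.≟ 0) (P? x)) (⟦⟧-× (f x ℕ.≟ 1) (P? x))))
    where
    left : ∀ y → y ≡ 1ℤ * y + 0ℤ * y
    left = solve-∀
    right : ∀ y → y ≡ 0ℤ * y + 1ℤ * y
    right = solve-∀
    values : ∀ i → i ≡ 0 ⊎ i ≡ 1 → + ⟦ P? x ⟧ ≡ + ⟦ i ℕ.≟ 0 ⟧ * + ⟦ P? x ⟧ + + ⟦ i ℕ.≟ 1 ⟧ * + ⟦ P? x ⟧
    values 0 (inj₁ refl) = left (+ ⟦ P? x ⟧)
    values 1 (inj₂ refl) = right (+ ⟦ P? x ⟧)

-- Prescribed values of e, z and s₁ at w pull back along a map g that preserves
-- e and turns the conditions on z and s₁ into conditions of the same form.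
#-W-pull : ∀ {k k′} (b : 𝔽₃^ k) (b′ : 𝔽₃^ k′) (g : 𝔽₃^ k → 𝔽₃^ k′) ε ζ c ζ′ c′ →
           (∀ w → e b′ (g w) ≡ e b w) →
           (∀ w → (z b′ (g w) ≡ ζ′ → z b w ≡ ζ) × (z b w ≡ ζ → z b′ (g w) ≡ ζ′)) →
           (∀ w → (s₁ b′ (g w) ≡ c′ → s₁ b w ≡ c) × (s₁ b w ≡ c → s₁ b′ (g w) ≡ c′)) →
           # (WClass? b′ ε ζ′ c′ ∘ g) ≡ # (WClass? b ε ζ c)
#-W-pull b b′ g ε ζ c ζ′ c′ eq-e iff-z iff-s = #-cong (WClass? b′ ε ζ′ c′ ∘ g) (WClass? b ε ζ c)
  (λ { w (p , q , r) → trans (sym (eq-e w)) p , proj₁ (iff-z w) q , proj₁ (iff-s w) r })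
  (λ { w (p , q , r) → trans (eq-e w) p , proj₂ (iff-z w) q , proj₂ (iff-s w) r })

≡-transport : ∀ {A : Set} {x y : A} {r : A} → x ≡ y → (x ≡ r → y ≡ r) × (y ≡ r → x ≡ r)
≡-transport x≡y = trans (sym x≡y) , trans x≡y

-- Induction on the box b, splitting on the first coordinates of b and of w.
#-W : ∀ {k} (b : 𝔽₃^ k) ε ζ c → + # (WClass? b ε ζ c) ≡ wCount (t b 0F) (t b 1F) (t b 2F) ε ζ c
#-W [] = base
  where
  base : ∀ ε ζ c → + # (WClass? [] ε ζ c) ≡ wCount 0 0 0 ε ζ c
  base 0             zero    c  = refl
  base 0             (suc ζ) c  = refl
  base 1             zero    0F = refl
  base 1             zero    1F = refl
  base 1             zero    2F = refl
  base 1             (suc ζ) c  = refl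
  base (suc (suc ε)) ζ       c  = refl
#-W {suc k} (b₀ ∷ b) ε ζ c = trans (cong +_ (#-suc (WClass? (b₀ ∷ b) ε ζ c))) (step b₀ ε ζ)
  where
  A? : ∀ b₀ ε ζ a → Decidable (λ w → WClass (b₀ ∷ b) ε ζ c (a ∷ w))
  A? b₀ ε ζ a w = WClass? (b₀ ∷ b) ε ζ c (a ∷ w)
  t₀ t₁ t₂ : ℕ
  t₀ = t b 0F
  t₁ = t b 1F
  t₂ = t b 2F

  b₀=0 : ∀ ε ζ a → + # (A? 0F ε ζ a) ≡ wCount t₀ t₁ t₂ ε ζ c
  b₀=0 ε ζ a = trans
    (cong +_ (#-W-pull b (0F ∷ b) (a ∷_) ε ζ c ζ c (λ w → e-there b w 0F a λ ())
      (λ w → ≡-transport (z-there b w 0F a λ ())) (λ w → ≡-transport (s₁-there b w 0F a λ ()))))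
    (#-W b ε ζ c)

  b₀=1-0-zero : ∀ ε → + # (A? 1F ε 0 0F) ≡ 0ℤ
  b₀=1-0-zero ε = cong +_ (#-∅ (A? 1F ε 0 0F) λ { w (_ , q , _) → ℕ.1+n≢0 (trans (sym (z-1-0 b w)) q) })

  b₀=1-0-suc : ∀ ε ζ → + # (A? 1F ε (suc ζ) 0F) ≡ wCount t₀ t₁ t₂ ε ζ c
  b₀=1-0-suc ε ζ = trans
    (cong +_ (#-W-pull b (1F ∷ b) (0F ∷_) ε ζ c (suc ζ) c (λ w → e-there b w 1F 0F λ ())
      (λ w → (λ q → ℕ.suc-injective (trans (sym (z-1-0 b w)) q)) , (λ q → trans (z-1-0 b w) (cong suc q)))
      (λ w → ≡-transport (trans (s₁-1 b w 0F) (⊕-identityˡ (s₁ b w))))))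
    (#-W b ε ζ c)

  b₀=1-suc : ∀ ε ζ a → + # (A? 1F ε ζ (suc a)) ≡ wCount t₀ t₁ t₂ ε ζ (2F ⊗ suc a ⊕ c)
  b₀=1-suc ε ζ a = trans
    (cong +_ (#-W-pull b (1F ∷ b) (suc a ∷_) ε ζ (2F ⊗ suc a ⊕ c) ζ c (λ w → e-there b w 1F (suc a) λ ())
      (λ w → ≡-transport (z-1-suc b w a))
      (λ w → (λ r → ⊕-solve (suc a) (s₁ b w) c (trans (sym (s₁-1 b w (suc a))) r))
           , (λ r → trans (s₁-1 b w (suc a)) (⊕-unsolve (suc a) (s₁ b w) c r)))))
    (#-W b ε ζ (2F ⊗ suc a ⊕ c))

  b₀=2-0 : ∀ ε ζ → + # (A? 2F ε ζ 0F) ≡ wCount t₀ t₁ t₂ ε ζ c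
  b₀=2-0 ε ζ = trans
    (cong +_ (#-W-pull b (2F ∷ b) (0F ∷_) ε ζ c ζ c (e-2-0 b)
      (λ w → ≡-transport (z-there b w 2F 0F λ ())) (λ w → ≡-transport (s₁-there b w 2F 0F λ ()))))
    (#-W b ε ζ c)

  -- A nonzero coordinate in T₂ makes e vanish whatever the tail is, so the tail is
  -- restricted by z and s₁ only.
  b₀=2-suc-0 : ∀ ζ a → + # (A? 2F 0 ζ (suc a)) ≡ wCount t₀ t₁ t₂ 0 ζ c + wCount t₀ t₁ t₂ 1 ζ c
  b₀=2-suc-0 ζ a = begin
    + # (A? 2F 0 ζ (suc a))                                  ≡⟨ cong +_ forget ⟩
    + # R?                                                   ≡⟨ #-split R? (e b) (e-bit b) ⟩
    + # (WClass? b 0 ζ c) + + # (WClass? b 1 ζ c)            ≡⟨ cong₂ _+_ (#-W b 0 ζ c) (#-W b 1 ζ c) ⟩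
    wCount t₀ t₁ t₂ 0 ζ c + wCount t₀ t₁ t₂ 1 ζ c            ∎
    where
    R? : Decidable (λ w → z b w ≡ ζ × s₁ b w ≡ c)
    R? w = (z b w ℕ.≟ ζ) ×-dec (s₁ b w Fin.≟ c)
    forget : # (A? 2F 0 ζ (suc a)) ≡ # R?
    forget = #-cong (A? 2F 0 ζ (suc a)) R?
      (λ { w (_ , q , r) → trans (sym (z-there b w 2F (suc a) λ ())) q , trans (sym (s₁-there b w 2F (suc a) λ ())) r })
      (λ { w (q , r) → e-2-suc b w a , trans (z-there b w 2F (suc a) λ ()) q , trans (s₁-there b w 2F (suc a) λ ()) r })

  b₀=2-suc-suc : ∀ ε ζ a → + # (A? 2F (suc ε) ζ (suc a)) ≡ 0ℤ
  b₀=2-suc-suc ε ζ a = cong +_ (#-∅ (A? 2F (suc ε) ζ (suc a))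
    λ { w (p , _) → ℕ.0≢1+n (trans (sym (e-2-suc b w a)) p) })

  triple : ∀ B M q → B * M * q + B * M * q + B * M * q ≡ B * M * (+ 3 * q)
  triple = solve-∀
  collect₂ : ∀ B x y q → 0ℤ + B * x * q + B * y * q ≡ B * (x + y) * q
  collect₂ = solve-∀
  collect₃ : ∀ B x y y′ q → B * x * q + B * y * q + B * y′ * q ≡ B * (x + y + y′) * q
  collect₃ = solve-∀
  bit-0 : ∀ p M q → (0ℤ + (p - 1ℤ) * 1ℤ) * M * q
                    + ((0ℤ + (p - 1ℤ) * 1ℤ) * M * q + (1ℤ + (p - 1ℤ) * 0ℤ) * M * q)
                    + ((0ℤ + (p - 1ℤ) * 1ℤ) * M * q + (1ℤ + (p - 1ℤ) * 0ℤ) * M * q)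
                  ≡ (0ℤ + (+ 3 * p - 1ℤ) * 1ℤ) * M * q
  bit-0 = solve-∀
  bit-suc : ∀ p i M q → (i + (p - 1ℤ) * 0ℤ) * M * q + 0ℤ + 0ℤ ≡ (i + (+ 3 * p - 1ℤ) * 0ℤ) * M * q
  bit-suc = solve-∀

  step : ∀ b₀ ε ζ → + # (A? b₀ ε ζ 0F) + + # (A? b₀ ε ζ 1F) + + # (A? b₀ ε ζ 2F) ≡
                    wCount (t (b₀ ∷ b) 0F) (t (b₀ ∷ b) 1F) (t (b₀ ∷ b) 2F) ε ζ c
  step 0F ε ζ = trans
    (cong₂ _+_ (cong₂ _+_ (b₀=0 ε ζ 0F) (b₀=0 ε ζ 1F)) (b₀=0 ε ζ 2F))
    (trans (triple (bitCount t₂ ε) (binomialN t₁ ζ c) ((+ 3) ^ t₀))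
           (sym (wCount-cong ε ζ c (t-here b 0F) (t-there 0F b λ ()) (t-there 0F b λ ()))))
  step 1F ε zero = trans
    (cong₂ _+_ (cong₂ _+_ (b₀=1-0-zero ε) (b₀=1-suc ε 0 0F)) (b₀=1-suc ε 0 1F))
    (trans (trans (collect₂ (bitCount t₂ ε) (binomialN t₁ 0 (2F ⊕ c)) (binomialN t₁ 0 (1F ⊕ c)) ((+ 3) ^ t₀))
                  (cong (λ M → bitCount t₂ ε * M * (+ 3) ^ t₀) (sym (binomialN-suc-0 t₁ c))))
           (sym (wCount-cong ε 0 c (t-there 1F b λ ()) (t-here b 1F) (t-there 1F b λ ()))))
  step 1F ε (suc ζ) = trans
    (cong₂ _+_ (cong₂ _+_ (b₀=1-0-suc ε ζ) (b₀=1-suc ε (suc ζ) 0F)) (b₀=1-suc ε (suc ζ) 1F))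
    (trans (trans (collect₃ (bitCount t₂ ε) (binomialN t₁ ζ c) (binomialN t₁ (suc ζ) (2F ⊕ c))
                            (binomialN t₁ (suc ζ) (1F ⊕ c)) ((+ 3) ^ t₀))
                  (cong (λ M → bitCount t₂ ε * M * (+ 3) ^ t₀) (sym (binomialN-suc-suc t₁ ζ c))))
           (sym (wCount-cong ε (suc ζ) c (t-there 1F b λ ()) (t-here b 1F) (t-there 1F b λ ()))))
  step 2F zero ζ = trans
    (cong₂ _+_ (cong₂ _+_ (b₀=2-0 0 ζ) (b₀=2-suc-0 ζ 0F)) (b₀=2-suc-0 ζ 1F))
    (trans (bit-0 ((+ 3) ^ t₂) (binomialN t₁ ζ c) ((+ 3) ^ t₀))
           (sym (wCount-cong 0 ζ c (t-there 2F b λ ()) (t-there 2F b λ ()) (t-here b 2F))))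
  step 2F (suc ε) ζ = trans
    (cong₂ _+_ (cong₂ _+_ (b₀=2-0 (suc ε) ζ) (b₀=2-suc-suc ε ζ 0F)) (b₀=2-suc-suc ε ζ 1F))
    (trans (bit-suc ((+ 3) ^ t₂) (+ ⟦ suc ε ℕ.≟ 1 ⟧) (binomialN t₁ ζ c) ((+ 3) ^ t₀))
           (sym (wCount-cong (suc ε) ζ c (t-there 2F b λ ()) (t-there 2F b λ ()) (t-here b 2F))))

-- The shape of the family of ideals

↑-elim : ∀ m {k p} (P : Fin (m ℕ.+ k) → Set p) → (∀ i → P (i ↑ˡ k)) → (∀ j → P (m ↑ʳ j)) → ∀ i → P i
↑-elim zero    P l r i       = r i
↑-elim (suc m) P l r zero    = l zero
↑-elim (suc m) P l r (suc i) = ↑-elim m (P ∘ suc) (l ∘ suc) r i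

↑ˡ-< : ∀ {m} k (i : Fin m) → toℕ (i ↑ˡ k) < m
↑ˡ-< k i rewrite Fin.toℕ-↑ˡ i k = Fin.toℕ<n i

↑ʳ-≥ : ∀ m {k} (j : Fin k) → m ≤ toℕ (m ↑ʳ j)
↑ʳ-≥ m j rewrite Fin.toℕ-↑ʳ m j = ℕ.m≤m+n m (toℕ j)

nonzero-coordinate : ∀ {k} (w : 𝔽₃^ k) → w ≢ 𝟎 → ∃ (Supp w)
nonzero-coordinate []          w≢𝟎 = contradiction refl w≢𝟎
nonzero-coordinate (0F ∷ w)    w≢𝟎 with nonzero-coordinate w (w≢𝟎 ∘ cong (0F ∷_))
... | j , wⱼ≢0 = suc j , wⱼ≢0
nonzero-coordinate (suc a ∷ w) w≢𝟎 = zero , λ ()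

constant-𝟐 : ∀ {m} (v : 𝔽₃^ m) → (∀ i → lookup v i ≡ 2F) → v ≡ 𝟐
constant-𝟐 []      _  = refl
constant-𝟐 (a ∷ v) eq = cong₂ _∷_ (eq zero) (constant-𝟐 v (eq ∘ suc))

𝟎-⊑ : ∀ {k} (b : 𝔽₃^ k) → 𝟎 ⊑ b
𝟎-⊑ b i = subst (Fin._≤ lookup b i) (sym (Vec.lookup-replicate i 0F)) (z≤n {toℕ (lookup b i)})

module _ (m : ℕ) {k} (b : 𝔽₃^ k) where

  -- The ideals contained in [m]₂ ∪ b.
  Ideal : Pred (𝔽₃^ (m ℕ.+ k)) _
  Ideal = Ideals⊑ (ℍ m (m ℕ.+ k)) (𝟐 {m} ++ b)

  Ideal? : Decidable Ideal
  Ideal? = Ideals⊑? (ℍ m (m ℕ.+ k)) (ℍ? m (m ℕ.+ k)) (𝟐 {m} ++ b)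

  -- An element of the upper layer forces full multiplicity on the lower one.
  Ideal-split : ∀ v w → Ideal (v ++ w) → w ≡ 𝟎 ⊎ (v ≡ 𝟐 × w ⊑ b × w ≢ 𝟎)
  Ideal-split v w ((_ , saturated) , J⊑I) with w ≟ 𝟎
  ... | yes w≡𝟎 = inj₁ w≡𝟎
  ... | no  w≢𝟎 with nonzero-coordinate w w≢𝟎
  ...   | j , wⱼ≢0 = inj₂ (constant-𝟐 v full , below-b , w≢𝟎)
    where
    full : ∀ i → lookup v i ≡ 2F
    full i = trans (sym (Vec.lookup-++ˡ v w i))
      (saturated (i ↑ˡ k) (m ↑ʳ j) (↑ˡ-< k i , ↑ʳ-≥ m j) (wⱼ≢0 ∘ trans (sym (Vec.lookup-++ʳ v w j))))
    below-b : w ⊑ b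
    below-b i = subst₂ Fin._≤_ (Vec.lookup-++ʳ v w i) (Vec.lookup-++ʳ (𝟐 {m}) b i) (J⊑I (m ↑ʳ i))

  ++-⊑ : ∀ v w → w ⊑ b → (v ++ w) ⊑ (𝟐 {m} ++ b)
  ++-⊑ v w w⊑b = ↑-elim m (λ i → lookup (v ++ w) i Fin.≤ lookup (𝟐 {m} ++ b) i)
    (λ i → subst (lookup (v ++ w) (i ↑ˡ k) Fin.≤_)
                 (sym (trans (Vec.lookup-++ˡ (𝟐 {m}) b i) (Vec.lookup-replicate i 2F)))
                 (Fin.toℕ≤pred[n] (lookup (v ++ w) (i ↑ˡ k))))
    (λ j → subst₂ Fin._≤_ (sym (Vec.lookup-++ʳ v w j)) (sym (Vec.lookup-++ʳ (𝟐 {m}) b j)) (w⊑b j))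

  -- With nothing in the upper layer both closure conditions are vacuous.
  Ideal-𝟎 : ∀ v → Ideal (v ++ 𝟎)
  Ideal-𝟎 v = ((λ i j (_ , m≤j) Jⱼ≢0 → contradiction (upper j m≤j) Jⱼ≢0)
             , (λ i j (_ , m≤j) Jⱼ≢0 → contradiction (upper j m≤j) Jⱼ≢0))
            , ++-⊑ v 𝟎 (𝟎-⊑ b)
    where
    upper : ∀ j → m ≤ toℕ j → lookup (v ++ 𝟎 {k}) j ≡ 0F
    upper = ↑-elim m (λ j → m ≤ toℕ j → lookup (v ++ 𝟎 {k}) j ≡ 0F)
      (λ i m≤i → contradiction m≤i (ℕ.<⇒≱ (↑ˡ-< k i)))
      (λ j _ → trans (Vec.lookup-++ʳ v 𝟎 j) (Vec.lookup-replicate j 0F))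

  -- A full lower layer satisfies both closure conditions, whatever lies above it.
  Ideal-𝟐 : ∀ w → w ⊑ b → Ideal (𝟐 ++ w)
  Ideal-𝟐 w w⊑b = ((λ i j (i<m , _) _ Jᵢ≡0 → contradiction (trans (sym Jᵢ≡0) (lower i i<m)) λ ())
                 , (λ i j (i<m , _) _ → lower i i<m))
                , ++-⊑ 𝟐 w w⊑b
    where
    lower : ∀ i → toℕ i < m → lookup (𝟐 {m} ++ w) i ≡ 2F
    lower = ↑-elim m (λ i → toℕ i < m → lookup (𝟐 {m} ++ w) i ≡ 2F)
      (λ i _ → trans (Vec.lookup-++ˡ (𝟐 {m}) w i) (Vec.lookup-replicate i 2F))
      (λ j j<m → contradiction (↑ʳ-≥ m j) (ℕ.<⇒≱ j<m))

  Ideal-shape : Ideal ≐ (U {A = 𝔽₃^ m} ⊠ ｛ 𝟎 {k} ｝) ∪ (｛ 𝟐 {m} ｝ ⊠ (Box b ∖ ｛ 𝟎 ｝))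
  Ideal-shape = (λ {J} → to J) , (λ {J} → from J)
    where
    to : ∀ J → Ideal J → ((U {A = 𝔽₃^ m} ⊠ ｛ 𝟎 {k} ｝) ∪ (｛ 𝟐 {m} ｝ ⊠ (Box b ∖ ｛ 𝟎 ｝))) J
    to J ideal with Ideal-split (take m J) (drop m J) (subst Ideal (sym (Vec.take++drop≡id m J)) ideal)
    ... | inj₁ w≡𝟎                   = inj₁ (tt , sym w≡𝟎)
    ... | inj₂ (v≡𝟐 , w⊑b , w≢𝟎) = inj₂ (sym v≡𝟐 , w⊑b , w≢𝟎 ∘ sym)
    from : ∀ J → ((U {A = 𝔽₃^ m} ⊠ ｛ 𝟎 {k} ｝) ∪ (｛ 𝟐 {m} ｝ ⊠ (Box b ∖ ｛ 𝟎 ｝))) J → Ideal J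
    from J (inj₁ (_ , 𝟎≡w)) = subst Ideal
      (trans (cong (take m J ++_) 𝟎≡w) (Vec.take++drop≡id m J)) (Ideal-𝟎 (take m J))
    from J (inj₂ (𝟐≡v , w⊑b , _)) = subst Ideal
      (trans (cong (_++ drop m J) 𝟐≡v) (Vec.take++drop≡id m J)) (Ideal-𝟐 (drop m J) w⊑b)

  Ideal-indicator : ∀ v w → + ⟦ Ideal? (v ++ w) ⟧ ≡ + ⟦ w ≟ 𝟎 ⟧ + + ⟦ v ≟ 𝟐 ⟧ * (+ ⟦ w ⊑? b ⟧ - + ⟦ w ≟ 𝟎 ⟧)
  Ideal-indicator v w = cases (v ≟ 𝟐) (w ≟ 𝟎) (w ⊑? b)
    where
    value : ∀ {i} → ⟦ Ideal? (v ++ w) ⟧ ≡ i → + ⟦ Ideal? (v ++ w) ⟧ ≡ + i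
    value eq = cong +_ eq
    cases : (v≟𝟐 : Dec (v ≡ 𝟐)) (w≟𝟎 : Dec (w ≡ 𝟎)) (w⊑?b : Dec (w ⊑ b)) →
            + ⟦ Ideal? (v ++ w) ⟧ ≡ + ⟦ w≟𝟎 ⟧ + + ⟦ v≟𝟐 ⟧ * (+ ⟦ w⊑?b ⟧ - + ⟦ w≟𝟎 ⟧)
    cases _          (yes refl) (no 𝟎⋢b)  = contradiction (𝟎-⊑ b) 𝟎⋢b
    cases (yes _)    (yes refl) (yes _)   = value (⟦⟧-yes (Ideal? (v ++ w)) (Ideal-𝟎 v))
    cases (no _)     (yes refl) (yes _)   = value (⟦⟧-yes (Ideal? (v ++ w)) (Ideal-𝟎 v))
    cases (yes refl) (no _)     (yes w⊑b) = value (⟦⟧-yes (Ideal? (v ++ w)) (Ideal-𝟐 w w⊑b))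
    cases (yes _)    (no w≢𝟎)   (no w⋢b)  = value (⟦⟧-no (Ideal? (v ++ w)) (outside ∘ Ideal-split v w))
      where
      outside : ¬ (w ≡ 𝟎 ⊎ (v ≡ 𝟐 × w ⊑ b × w ≢ 𝟎))
      outside (inj₁ w≡𝟎)           = w≢𝟎 w≡𝟎
      outside (inj₂ (_ , w⊑b , _)) = w⋢b w⊑b
    cases (no v≢𝟐)   (no w≢𝟎)   _         = value (⟦⟧-no (Ideal? (v ++ w)) (outside ∘ Ideal-split v w))
      where
      outside : ¬ (w ≡ 𝟎 ⊎ (v ≡ 𝟐 × w ⊑ b × w ≢ 𝟎))
      outside (inj₁ w≡𝟎)       = w≢𝟎 w≡𝟎
      outside (inj₂ (v≡𝟐 , _)) = v≢𝟐 v≡𝟐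

  -- The subspace w = 0 and the box above 𝟐 meet exactly in (𝟐, 𝟎).
  ∑-Ideal : ∀ (f : 𝔽₃^ (m ℕ.+ k) → ℤ) → ∑ (λ x → + ⟦ Ideal? x ⟧ * f x) ≡
                  ∑ {m} (λ v → f (v ++ 𝟎 {k})) + (∑ (λ w → + ⟦ w ⊑? b ⟧ * f (𝟐 {m} ++ w)) - f (𝟐 {m} ++ 𝟎 {k}))
  ∑-Ideal f = begin
    ∑ (λ x → + ⟦ Ideal? x ⟧ * f x)                                   ≡⟨ ∑-++ m (λ x → + ⟦ Ideal? x ⟧ * f x) ⟩
    ∑ {m} (λ v → ∑ {k} (λ w → + ⟦ Ideal? (v ++ w) ⟧ * f (v ++ w)))   ≡⟨ ∑-cong {m} inner ⟩
    ∑ {m} (λ v → f (v ++ 𝟎 {k}) + + ⟦ v ≟ 𝟐 ⟧ * G v)                     ≡⟨ ∑-+ {m} (λ v → f (v ++ 𝟎 {k})) (λ v → + ⟦ v ≟ 𝟐 ⟧ * G v) ⟩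
    ∑ {m} (λ v → f (v ++ 𝟎 {k})) + ∑ {m} (λ v → + ⟦ v ≟ 𝟐 ⟧ * G v)       ≡⟨ cong (λ i → ∑ {m} (λ v → f (v ++ 𝟎 {k})) + i) (∑-δ {m} 𝟐 G) ⟩
    ∑ {m} (λ v → f (v ++ 𝟎 {k})) + G 𝟐                                   ∎
    where
    δ β : 𝔽₃^ m → 𝔽₃^ k → ℤ
    δ v w = + ⟦ w ≟ 𝟎 ⟧ * f (v ++ w)
    β v w = + ⟦ w ⊑? b ⟧ * f (v ++ w)
    G : 𝔽₃^ m → ℤ
    G v = ∑ (β v) - f (v ++ 𝟎 {k})
    distrib : ∀ x y p g → (x + y * (p - x)) * g ≡ x * g + y * (p * g - x * g)
    distrib = solve-∀
    inner : ∀ v → ∑ {k} (λ w → + ⟦ Ideal? (v ++ w) ⟧ * f (v ++ w)) ≡ f (v ++ 𝟎 {k}) + + ⟦ v ≟ 𝟐 ⟧ * G v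
    inner v = begin
      ∑ {k} (λ w → + ⟦ Ideal? (v ++ w) ⟧ * f (v ++ w))
        ≡⟨ ∑-cong {k} (λ w → trans (cong (_* f (v ++ w)) (Ideal-indicator v w))
             (distrib (+ ⟦ w ≟ 𝟎 ⟧) (+ ⟦ v ≟ 𝟐 ⟧) (+ ⟦ w ⊑? b ⟧) (f (v ++ w)))) ⟩
      ∑ {k} (λ w → δ v w + + ⟦ v ≟ 𝟐 ⟧ * (β v w - δ v w))
        ≡⟨ ∑-+ {k} (δ v) (λ w → + ⟦ v ≟ 𝟐 ⟧ * (β v w - δ v w)) ⟩
      ∑ (δ v) + ∑ {k} (λ w → + ⟦ v ≟ 𝟐 ⟧ * (β v w - δ v w))
        ≡⟨ cong (λ i → ∑ (δ v) + i) (trans (∑-*ˡ {k} (+ ⟦ v ≟ 𝟐 ⟧) (λ w → β v w - δ v w))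
                                           (cong (+ ⟦ v ≟ 𝟐 ⟧ *_) (∑-- {k} (β v) (δ v)))) ⟩
      ∑ (δ v) + + ⟦ v ≟ 𝟐 ⟧ * (∑ (β v) - ∑ (δ v))
        ≡⟨ cong (λ i → i + + ⟦ v ≟ 𝟐 ⟧ * (∑ (β v) - i)) (∑-δ {k} 𝟎 (λ w → f (v ++ w))) ⟩
      f (v ++ 𝟎 {k}) + + ⟦ v ≟ 𝟐 ⟧ * G v ∎

  -- Length and weights

  private
    -- The defining set of the code.
    D : List (𝔽₃^ (m ℕ.+ k))
    D = complement m (m ℕ.+ k) (𝟐 {m} ++ b)

  D-∑ : + length D ≡ ∑ (λ x → + ⟦ ¬? (Ideal? x) ⟧)
  D-∑ = #-∑ (∁? Ideal?)

  length-D : + length D ≡ (+ 3) ^ (m ℕ.+ k) - (+ 3) ^ m - (+ 2) ^ t b 1F * (+ 3) ^ t b 2F + 1ℤ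
  length-D = begin
    + length D                                     ≡⟨ D-∑ ⟩
    ∑ (λ x → + ⟦ ¬? (Ideal? x) ⟧)                  ≡⟨ ∑-cong (λ x → trans (⟦⟧-¬ (Ideal? x))
                                                        (cong (λ i → 1ℤ - i) (sym (ℤ.*-identityʳ (+ ⟦ Ideal? x ⟧))))) ⟩
    ∑ (λ x → 1ℤ - + ⟦ Ideal? x ⟧ * 1ℤ)             ≡⟨ ∑-- {m ℕ.+ k} (λ _ → 1ℤ) (λ x → + ⟦ Ideal? x ⟧ * 1ℤ) ⟩
    ∑ {m ℕ.+ k} (λ _ → 1ℤ) - ∑ (λ x → + ⟦ Ideal? x ⟧ * 1ℤ)
      ≡⟨ cong₂ _-_ (∑-const (m ℕ.+ k) 1ℤ) (∑-Ideal (λ _ → 1ℤ)) ⟩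
    q * 1ℤ - (∑ {m} (λ _ → 1ℤ) + (∑ {k} (λ w → + ⟦ w ⊑? b ⟧ * 1ℤ) - 1ℤ))
      ≡⟨ cong₂ (λ x y → q * 1ℤ - (x + (y - 1ℤ))) (∑-const m 1ℤ) (∑-box-1 b) ⟩
    q * 1ℤ - ((+ 3) ^ m * 1ℤ + ((+ 2) ^ t b 1F * (+ 3) ^ t b 2F - 1ℤ))
      ≡⟨ rearrange q ((+ 3) ^ m) ((+ 2) ^ t b 1F * (+ 3) ^ t b 2F) ⟩
    q - (+ 3) ^ m - (+ 2) ^ t b 1F * (+ 3) ^ t b 2F + 1ℤ ∎
    where
    q : ℤ
    q = (+ 3) ^ (m ℕ.+ k)
    rearrange : ∀ x y z → x * 1ℤ - (y * 1ℤ + (z - 1ℤ)) ≡ x - y - z + 1ℤ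
    rearrange = solve-∀

  -- The character sum over the ideals.
  ∑-Ideal-φ : ∀ v w → ∑ (λ x → + ⟦ Ideal? x ⟧ * φ ((v ++ w) · x)) ≡
              (+ 3) ^ m * + ⟦ v ≟ 𝟎 ⟧ * + 2
              + (boxValue (t b 2F) (e b w) (z b w) (o b w) (Σ𝔽₃ v ⊕ s₁ b w) - φ (Σ𝔽₃ v))
  ∑-Ideal-φ v w = trans (∑-Ideal (λ x → φ ((v ++ w) · x))) (cong₂ _+_ lower (cong₂ _-_ box origin))
    where
    σ : 𝔽₃
    σ = Σ𝔽₃ v
    lower : ∑ {m} (λ x → φ ((v ++ w) · (x ++ 𝟎 {k}))) ≡ (+ 3) ^ m * + ⟦ v ≟ 𝟎 ⟧ * + 2
    lower = trans
      (∑-cong {m} λ x → cong φ (begin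
        (v ++ w) · (x ++ 𝟎 {k})  ≡⟨ ·-++ v x w 𝟎 ⟩
        v · x ⊕ w · 𝟎        ≡⟨ cong (v · x ⊕_) (·-𝟎 w) ⟩
        v · x ⊕ 0F           ≡⟨ ⊕-identityʳ (v · x) ⟩
        v · x                ≡⟨ ⊕-identityˡ (v · x) ⟨
        0F ⊕ v · x           ∎))
      (∑-φ v 0F)
    upper : ∀ y → (v ++ w) · (𝟐 {m} ++ y) ≡ 2F ⊗ σ ⊕ w · y
    upper y = trans (·-++ v 𝟐 w y) (cong (_⊕ w · y) (·-𝟐 v))
    box : ∑ (λ y → + ⟦ y ⊑? b ⟧ * φ ((v ++ w) · (𝟐 {m} ++ y))) ≡
          boxValue (t b 2F) (e b w) (z b w) (o b w) (σ ⊕ s₁ b w)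
    box = trans
      (trans (∑-cong λ y → cong (λ c → + ⟦ y ⊑? b ⟧ * φ c) (upper y)) (∑-box-φ b w (2F ⊗ σ)))
      (cong ((+ 3) ^ t b 2F * + e b w * (+ 2) ^ z b w * -1ℤ ^ o b w *_)
        (trans (cong φ (sym (2⊗-⊕ σ (s₁ b w)))) (φ-even (σ ⊕ s₁ b w))))
    origin : φ ((v ++ w) · (𝟐 {m} ++ 𝟎 {k})) ≡ φ σ
    origin = trans
      (cong φ (trans (upper 𝟎) (trans (cong (2F ⊗ σ ⊕_) (·-𝟎 w)) (⊕-identityʳ (2F ⊗ σ)))))
      (φ-even σ)

  -- Three times the weight of the codeword of v ++ w.
  tripleWeight : 𝔽₃^ m → 𝔽₃^ k → ℤ
  tripleWeight v w =
    + 2 * + length D + + 2 * (+ 3) ^ m * + ⟦ v ≟ 𝟎 ⟧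
    + boxValue (t b 2F) (e b w) (z b w) (o b w) (Σ𝔽₃ v ⊕ s₁ b w) - φ (Σ𝔽₃ v)

  -- By 3[c ≠ 0] = 2 - φ(c), summed over the complement of the ideals.
  weight : ∀ v w → v ++ w ≢ 𝟎 → + wt (codeword D (v ++ w)) * + 3 ≡ tripleWeight v w
  weight v w u≢𝟎 = begin
    + wt (codeword D u) * + 3                                ≡⟨ cong (_* + 3) (wt-∑ (∁? Ideal?) u) ⟩
    ∑ (λ x → c x * d x) * + 3                                ≡⟨ ℤ.*-comm (∑ (λ x → c x * d x)) (+ 3) ⟩
    + 3 * ∑ (λ x → c x * d x)                                ≡⟨ ∑-*ˡ (+ 3) (λ x → c x * d x) ⟨
    ∑ (λ x → + 3 * (c x * d x))                              ≡⟨ ∑-cong pointwise ⟩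
    ∑ (λ x → + 2 * c x - (f x - i x * f x))                  ≡⟨ ∑-- (λ x → + 2 * c x) (λ x → f x - i x * f x) ⟩
    ∑ (λ x → + 2 * c x) - ∑ (λ x → f x - i x * f x)
      ≡⟨ cong₂ _-_ (∑-*ˡ (+ 2) c) (∑-- f (λ x → i x * f x)) ⟩
    + 2 * ∑ c - (∑ f - ∑ (λ x → i x * f x))
      ≡⟨ cong₂ (λ x y → + 2 * x - (y - ∑ (λ x → i x * f x))) (sym D-∑) ∑f≡0 ⟩
    + 2 * + length D - (0ℤ - ∑ (λ x → i x * f x))
      ≡⟨ cong (λ y → + 2 * + length D - (0ℤ - y)) (∑-Ideal-φ v w) ⟩
    + 2 * + length D - (0ℤ - ((+ 3) ^ m * + ⟦ v ≟ 𝟎 ⟧ * + 2 + (B - φ (Σ𝔽₃ v))))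
      ≡⟨ rearrange (+ length D) ((+ 3) ^ m) (+ ⟦ v ≟ 𝟎 ⟧) B (φ (Σ𝔽₃ v)) ⟩
    + 2 * + length D + + 2 * (+ 3) ^ m * + ⟦ v ≟ 𝟎 ⟧ + B - φ (Σ𝔽₃ v) ∎
    where
    u : 𝔽₃^ (m ℕ.+ k)
    u = v ++ w
    i c d f : 𝔽₃^ (m ℕ.+ k) → ℤ
    i x = + ⟦ Ideal? x ⟧
    c x = + ⟦ ¬? (Ideal? x) ⟧
    d x = + ⟦ ¬? (u · x Fin.≟ 0F) ⟧
    f x = φ (u · x)
    B : ℤ
    B = boxValue (t b 2F) (e b w) (z b w) (o b w) (Σ𝔽₃ v ⊕ s₁ b w)
    swap : ∀ x y → + 3 * (x * y) ≡ x * (+ 3 * y)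
    swap = solve-∀
    expand : ∀ x y → (1ℤ - x) * (+ 2 - y) ≡ + 2 * (1ℤ - x) - (y - x * y)
    expand = solve-∀
    pointwise : ∀ x → + 3 * (c x * d x) ≡ + 2 * c x - (f x - i x * f x)
    pointwise x = begin
      + 3 * (c x * d x)                          ≡⟨ swap (c x) (d x) ⟩
      c x * (+ 3 * d x)                          ≡⟨ cong₂ _*_ (⟦⟧-¬ (Ideal? x)) (φ-indicator (u · x)) ⟩
      (1ℤ - i x) * (+ 2 - f x)                   ≡⟨ expand (i x) (f x) ⟩
      + 2 * (1ℤ - i x) - (f x - i x * f x)       ≡⟨ cong (λ y → + 2 * y - (f x - i x * f x)) (⟦⟧-¬ (Ideal? x)) ⟨
      + 2 * c x - (f x - i x * f x)              ∎
    ∑f≡0 : ∑ f ≡ 0ℤ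
    ∑f≡0 = begin
      ∑ f                                            ≡⟨ ∑-cong (λ x → cong φ (sym (⊕-identityˡ (u · x)))) ⟩
      ∑ (λ x → φ (0F ⊕ u · x))                       ≡⟨ ∑-φ u 0F ⟩
      (+ 3) ^ (m ℕ.+ k) * + ⟦ u ≟ 𝟎 ⟧ * + 2
        ≡⟨ cong (λ y → (+ 3) ^ (m ℕ.+ k) * + y * + 2) (⟦⟧-no (u ≟ 𝟎) u≢𝟎) ⟩
      (+ 3) ^ (m ℕ.+ k) * 0ℤ * + 2                   ≡⟨ cong (_* + 2) (ℤ.*-zeroʳ ((+ 3) ^ (m ℕ.+ k))) ⟩
      0ℤ                                             ∎
    rearrange : ∀ l q x y s → + 2 * l - (0ℤ - (q * x * + 2 + (y - s))) ≡ + 2 * l + + 2 * q * x + y - s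
    rearrange = solve-∀

-- The size of a class

take-++ : ∀ {m k} (v : 𝔽₃^ m) (w : 𝔽₃^ k) → take m (v ++ w) ≡ v × drop m (v ++ w) ≡ w
take-++ {m} v w = Vec.++-injective (take m (v ++ w)) v (Vec.take++drop≡id m (v ++ w))

#-⊠ : ∀ {m k p q} {P : Pred (𝔽₃^ m) p} {Q : Pred (𝔽₃^ k) q} (P? : Decidable P) (Q? : Decidable Q) →
      + # (P? ⊠? Q?) ≡ + # P? * + # Q?
#-⊠ {m} {k} P? Q? = begin
  + # (P? ⊠? Q?)                                                ≡⟨ #-∑ (P? ⊠? Q?) ⟩
  ∑ (λ u → + ⟦ (P? ⊠? Q?) u ⟧)                                  ≡⟨ ∑-++ m (λ u → + ⟦ (P? ⊠? Q?) u ⟧) ⟩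
  ∑ {m} (λ v → ∑ {k} (λ w → + ⟦ (P? ⊠? Q?) (v ++ w) ⟧))         ≡⟨ ∑-cong {m} (λ v → ∑-cong {k} (factor v)) ⟩
  ∑ {m} (λ v → ∑ {k} (λ w → p v * q w))                         ≡⟨ ∑-cong {m} (λ v → ∑-*ˡ {k} (p v) q) ⟩
  ∑ {m} (λ v → p v * ∑ q)                                       ≡⟨ ∑-cong {m} (λ v → ℤ.*-comm (p v) (∑ q)) ⟩
  ∑ {m} (λ v → ∑ q * p v)                                       ≡⟨ ∑-*ˡ {m} (∑ q) p ⟩
  ∑ q * ∑ p                                                     ≡⟨ ℤ.*-comm (∑ q) (∑ p) ⟩
  ∑ p * ∑ q                                                     ≡⟨ cong₂ _*_ (#-∑ P?) (#-∑ Q?) ⟨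
  + # P? * + # Q?                                               ∎
  where
  p : 𝔽₃^ m → ℤ
  p v = + ⟦ P? v ⟧
  q : 𝔽₃^ k → ℤ
  q w = + ⟦ Q? w ⟧
  factor : ∀ v w → + ⟦ (P? ⊠? Q?) (v ++ w) ⟧ ≡ p v * q w
  factor v w = trans (⟦⟧-× (P? (take m (v ++ w))) (Q? (drop m (v ++ w))))
                     (cong₂ (λ x y → p x * q y) (proj₁ (take-++ v w)) (proj₂ (take-++ v w)))

#-Nonzero : ∀ {n p} {P : Pred (𝔽₃^ n) p} (P? : Decidable P) → + # (Nonzero? ∩? P?) ≡ + # P? - + ⟦ P? 𝟎 ⟧
#-Nonzero {n} P? = begin
  + # (Nonzero? ∩? P?)                              ≡⟨ #-∑ (Nonzero? ∩? P?) ⟩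
  ∑ (λ x → + ⟦ ¬? (x ≟ 𝟎) ×-dec P? x ⟧)             ≡⟨ ∑-cong split ⟩
  ∑ (λ x → f x - + ⟦ x ≟ 𝟎 ⟧ * f x)                 ≡⟨ ∑-- f (λ x → + ⟦ x ≟ 𝟎 ⟧ * f x) ⟩
  ∑ f - ∑ (λ x → + ⟦ x ≟ 𝟎 ⟧ * f x)                 ≡⟨ cong₂ _-_ (sym (#-∑ P?)) (∑-δ 𝟎 f) ⟩
  + # P? - f 𝟎                                      ∎
  where
  f : 𝔽₃^ n → ℤ
  f x = + ⟦ P? x ⟧
  distrib : ∀ x y → (1ℤ - x) * y ≡ y - x * y
  distrib = solve-∀
  split : ∀ x → + ⟦ ¬? (x ≟ 𝟎) ×-dec P? x ⟧ ≡ f x - + ⟦ x ≟ 𝟎 ⟧ * f x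
  split x = trans (⟦⟧-× (¬? (x ≟ 𝟎)) (P? x))
    (trans (cong (_* f x) (⟦⟧-¬ (x ≟ 𝟎))) (distrib (+ ⟦ x ≟ 𝟎 ⟧) (f x)))

#-U : ∀ m {k} (b : 𝔽₃^ k) a s ε ζ c →
      + # (Nonzero? ∩? UClass? {m} b a s ε ζ c) ≡
      + # (VClass? {m} a s) * (bitCount (t b 2F) ε * + (t b 1F C ζ) * + N c (t b 1F ∸ ζ) * (+ 3) ^ (k ∸ t b 1F ∸ t b 2F))
      - + ⟦ UClass? {m} b a s ε ζ c 𝟎 ⟧
#-U m {k} b a s ε ζ c = trans (#-Nonzero (UClass? {m} b a s ε ζ c))
  (cong (λ i → i - + ⟦ UClass? {m} b a s ε ζ c 𝟎 ⟧)
    (trans (#-⊠ (VClass? {m} a s) (WClass? b ε ζ c)) (cong (+ # (VClass? {m} a s) *_) (begin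
      + # (WClass? b ε ζ c)                            ≡⟨ #-W b ε ζ c ⟩
      β * (+ (t b 1F C ζ) * ν) * (+ 3) ^ t b 0F        ≡⟨ cong (_* (+ 3) ^ t b 0F) (ℤ.*-assoc β (+ (t b 1F C ζ)) ν) ⟨
      β * + (t b 1F C ζ) * ν * (+ 3) ^ t b 0F
        ≡⟨ cong (λ r → β * + (t b 1F C ζ) * ν * (+ 3) ^ r) (t₀-∸ b) ⟨
      β * + (t b 1F C ζ) * ν * (+ 3) ^ (k ∸ t b 1F ∸ t b 2F) ∎))))
  where
  β ν : ℤ
  β = bitCount (t b 2F) ε
  ν = + N c (t b 1F ∸ ζ)

-- Passage to rational numbers and conclusion

pos-^ : ∀ i n → + (i ℕ.^ n) ≡ (+ i) ^ n
pos-^ i zero    = refl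
pos-^ i (suc n) = trans (ℤ.pos-* i (i ℕ.^ n)) (cong (+ i *_) (pos-^ i n))

-- Clearing denominators.
/3-intro : ∀ i j → i * + 3 ≡ j → i / 1 ≡ j / 3
/3-intro i j eq = fromℚᵘ-cong {mkℚᵘ i 0} {mkℚᵘ j 2} (*≡* (trans eq (sym (ℤ.*-identityʳ j))))

φ-≢0 : ∀ c → c ≢ 0F → φ c ≡ -1ℤ
φ-≢0 0F c≢0 = contradiction refl c≢0
φ-≢0 1F _   = refl
φ-≢0 2F _   = refl

theorem6p4 : (m k : ℕ) → 1 ≤ m → 1 ≤ k → (vB : 𝔽₃^ k) → vB ≢ 𝟎 →
    let n = m ℕ.+ k
        I = 𝟐 {m} ++ vB
        D = complement m n I
        t₁ = t vB 1F
        t₂ = t vB 2F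
    in
    SaturatedIdeal (ℍ m n) I →
    -- the shape of I(𝔾ℙ)
    (Ideals⊑ (ℍ m n) I ≐ (U {A = 𝔽₃^ m} ⊠ ｛ 𝟎 {k} ｝) ∪ (｛ 𝟐 {m} ｝ ⊠ (Box vB ∖ ｛ 𝟎 ｝)))
    ×
    -- the length of the code
    (+ length D ≡ (+ 3) ^ n - (+ 3) ^ m - (+ 2) ^ t₁ * (+ 3) ^ t₂ + 1ℤ)
    ×
    -- the weights
    ((v : 𝔽₃^ m) (w : 𝔽₃^ k) → v ++ w ≢ 𝟎 →
      let σ = Σ𝔽₃ v in
      + wt (codeword D (v ++ w)) / 1 ≡
        (+ 2 * + length D
          + + 2 * (+ 3) ^ m * + ⟦ v ≟ 𝟎 ⟧
          + (+ 3) ^ t₂ * + e vB w * (+ 2) ^ z vB w * -1ℤ ^ o vB w * φ (σ ⊕ s₁ vB w)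
          - φ σ) / 3)
    ×
    -- the number of nonzero u in each class
    ((a : ℕ) (s : 𝔽₃) (ε ζ : ℕ) (c : 𝔽₃) →
      + # (Nonzero? ∩? UClass? {m} vB a s ε ζ c) ≡
        + # (VClass? {m} a s)
          * ((+ ⟦ ε ℕ.≟ 1 ⟧ + ((+ 3) ^ t₂ - 1ℤ) * + ⟦ ε ℕ.≟ 0 ⟧)
              * + (t₁ C ζ) * + N c (t₁ ∸ ζ) * (+ 3) ^ (k ∸ t₁ ∸ t₂))
        - + ⟦ UClass? {m} vB a s ε ζ c 𝟎 ⟧)
    ×
    -- the number of v in each class
    (# (VClass? {m} 1 0F) ≡ 1)
    ×
    (+ # (VClass? {m} 0 0F) ≡ (+ 3) ^ (m ∸ 1) - 1ℤ)
    ×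
    ((s : 𝔽₃) → s ≢ 0F → # (VClass? {m} 0 s) ≡ 3 ℕ.^ (m ∸ 1))
    ×
    -- the closed form of N
    ((r : ℕ) → + N 0F r / 1 ≡ ((+ 2) ^ r + + 2 * -1ℤ ^ r) / 3)
    ×
    ((c : 𝔽₃) → c ≢ 0F → (r : ℕ) → + N c r / 1 ≡ ((+ 2) ^ r - -1ℤ ^ r) / 3)
theorem6p4 (suc m) k _ _ vB _ _ =
    Ideal-shape (suc m) vB
  , length-D (suc m) vB
  , (λ v w u≢𝟎 → /3-intro
      (+ wt (codeword (complement (suc m) (suc m ℕ.+ k) (𝟐 {suc m} ++ vB)) (v ++ w)))
      (tripleWeight (suc m) vB v w)
      (weight (suc m) vB v w u≢𝟎))
  , #-U (suc m) vB
  , #-V₁ (suc m)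
  , #-V₀ m 0F
  , (λ s s≢0 → ℤ.+-injective (begin
      + # (VClass? {suc m} 0 s)       ≡⟨ #-V₀ m s ⟩
      (+ 3) ^ m - + ⟦ 0F Fin.≟ s ⟧    ≡⟨ cong (λ i → (+ 3) ^ m - + i) (⟦⟧-no (0F Fin.≟ s) (s≢0 ∘ sym)) ⟩
      (+ 3) ^ m + 0ℤ                  ≡⟨ ℤ.+-identityʳ ((+ 3) ^ m) ⟩
      (+ 3) ^ m                       ≡⟨ pos-^ 3 m ⟨
      + (3 ℕ.^ m)                     ∎))
  , (λ r → /3-intro (+ N 0F r) ((+ 2) ^ r + + 2 * -1ℤ ^ r) (N-closed 0F r))
  , (λ c c≢0 r → /3-intro (+ N c r) ((+ 2) ^ r - -1ℤ ^ r) (begin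
      + N c r * + 3                   ≡⟨ N-closed c r ⟩
      (+ 2) ^ r + φ c * -1ℤ ^ r       ≡⟨ cong (λ x → (+ 2) ^ r + x * -1ℤ ^ r) (φ-≢0 c c≢0) ⟩
      (+ 2) ^ r + -1ℤ * -1ℤ ^ r       ≡⟨ cong (λ i → (+ 2) ^ r + i) (ℤ.-1*i≡-i (-1ℤ ^ r)) ⟩
      (+ 2) ^ r - -1ℤ ^ r             ∎))
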